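{- Let $\mathbb{K}$ be a commutative ring with unit, and assume that $\mathbb{K}$ contains a primitive $n$-th root of unity $\xi$. Let $M$ be a matroid. Then the Tutte polynomial satisfies the following iterated convolution formula in the polynomial algebra $\mathbb{K}[x,y]$: $$\mathfrak{T}_M(x^n,y^n)=\sum_{\varnothing=A_0\subseteq A_1\subseteq\cdots\subseteq A_n=E(M)}\left(\prod_{i=1}^n(1-\xi^{i-1}x)^{\mathrm{rk}(M/A_i)}\,(1-\xi^{i-1}y)^{\mathrm{cork}(M|A_{i-1})}\,\mathfrak{T}_{M|A_i/A_{i-1}}(\xi^{i-1}x,\,\xi^{i-1}y)\right).$$
   Context: For a matroid $M$ with finite ground set $E(M)$ and rank function $\mathrm{rk}$: $\mathrm{rk}(M)=\mathrm{rk}(E(M))$, $\mathrm{cork}(M)=|E(M)|-\mathrm{rk}(M)$, and the Tutte polynomial is $\mathfrak{T}_M(x,y)=\sum_{A\subseteq E(M)}(x-1)^{\mathrm{rk}(M)-\mathrm{rk}(A)}(y-1)^{|A|-\mathrm{rk}(A)}$. $M|A$ is the restriction of $M$ to $A$, and $M/A$ is the contraction, a matroid on $E(M)\setminus A$ with rank function $B\mapsto \mathrm{rk}(A\cup B)-\mathrm{rk}(A)$. $M|A_i/A_{i-1}$ means $(M|A_i)/A_{i-1}$.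
   Formalization: "Primitive n-th root of unity" is taken to mean ξ^n=1 with ξ^k-1 a non-zero-divisor for 0<k<n; mere order n makes the formula false (ℤ/8, ξ=3, n=2, M a coloop: the sum is 4x-3x², not x²). -}

module Defs where

open import Algebra.Bundles using (CommutativeRing; Semiring)
import Algebra.Definitions.RawSemiring as RawSemiringDefs
open import Data.Fin using (Fin; zero; suc; toℕ; fromℕ; inject₁)
open import Data.Fin.Properties using (all?)
open import Data.Fin.Subset
  using (Subset; inside; outside; ⊥; _∈_; _⊆_; _∪_; _∩_; _─_; ∣_∣)
open import Data.Fin.Subset.Properties as Sub using (_⊆?_)
open import Data.Bool.Properties using () renaming (_≟_ to _≟ᵇ_)
open import Data.List using (List; []; _∷_; map; foldr; filter; mapMaybe; cartesianProductWith)
open import Data.Maybe as Maybe using ()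
open import Data.Nat as ℕ using (ℕ; zero; suc; _∸_; _≤_; _<_)
open import Data.Nat.Properties as ℕₚ using ()
open import Data.Product using (_,_)
open import Data.Sum using (inj₁; inj₂)
open import Data.Vec as Vec using ([]; _∷_)
open import Data.Vec.Properties using (≡-dec)
open import Data.Vec.Functional as Vector using (Vector)
open import Level using (_⊔_)
open import Relation.Binary.PropositionalEquality as ≡ using (_≡_; cong; subst; subst₂)
open import Relation.Nullary using (Dec; map′)
open import Relation.Nullary.Decidable using (_×-dec_; dec⇒maybe)

------------------------------------------------------------------------
-- Polynomials

-- A polynomial is a list of coefficients, constant term first.  Trailing
-- zeros are allowed, so equality is coefficientwise.

module Polynomial {c ℓ} (R : CommutativeRing c ℓ) where

  private module R = CommutativeRing R
  open R using (Carrier; _≈_; _+_; _*_; -_; 0#; 1#)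
  open import Relation.Binary.Reasoning.Setoid R.setoid
  open import Algebra.Properties.Ring R.ring using (-0#≈0#)
  open import Algebra.Properties.CommutativeSemigroup R.+-commutativeSemigroup
    using (interchange)

  Poly : Set c
  Poly = List Carrier

  coeff : Poly → ℕ → Carrier
  coeff []      _       = 0#
  coeff (a ∷ p) zero    = a
  coeff (a ∷ p) (suc i) = coeff p i

  infix 4 _≋_
  record _≋_ (p q : Poly) : Set ℓ where
    constructor mk≋
    field coeff≈ : ∀ i → coeff p i ≈ coeff q i
  open _≋_ public

  infixl 6 _⊕_
  infixl 7 _⊛_ _·_
  infix  8 ⊖_

  _⊕_ : Poly → Poly → Poly
  []      ⊕ q       = q
  (a ∷ p) ⊕ []      = a ∷ p
  (a ∷ p) ⊕ (b ∷ q) = (a + b) ∷ (p ⊕ q)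

  _·_ : Carrier → Poly → Poly
  a · p = map (a *_) p

  ⊖_ : Poly → Poly
  ⊖ p = map -_ p

  -- (a + X p) q = a q + X (p q)
  _⊛_ : Poly → Poly → Poly
  []      ⊛ q = []
  (a ∷ p) ⊛ q = (a · q) ⊕ (0# ∷ (p ⊛ q))

  const : Carrier → Poly
  const a = a ∷ []

  X : Poly
  X = 0# ∷ 1# ∷ []

  coeff-⊕ : ∀ p q i → coeff (p ⊕ q) i ≈ coeff p i + coeff q i
  coeff-⊕ []      q       i       = R.sym (R.+-identityˡ _)
  coeff-⊕ (a ∷ p) []      i       = R.sym (R.+-identityʳ _)
  coeff-⊕ (a ∷ p) (b ∷ q) zero    = R.refl
  coeff-⊕ (a ∷ p) (b ∷ q) (suc i) = coeff-⊕ p q i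

  coeff-· : ∀ a p i → coeff (a · p) i ≈ a * coeff p i
  coeff-· a []      i       = R.sym (R.zeroʳ a)
  coeff-· a (b ∷ p) zero    = R.refl
  coeff-· a (b ∷ p) (suc i) = coeff-· a p i

  coeff-⊖ : ∀ p i → coeff (⊖ p) i ≈ - coeff p i
  coeff-⊖ []      i       = R.sym -0#≈0#
  coeff-⊖ (b ∷ p) zero    = R.refl
  coeff-⊖ (b ∷ p) (suc i) = coeff-⊖ p i

  ≋-refl : ∀ {p} → p ≋ p
  ≋-refl = mk≋ λ i → R.refl

  ≋-sym : ∀ {p q} → p ≋ q → q ≋ p
  ≋-sym e = mk≋ λ i → R.sym (coeff≈ e i)

  ≋-trans : ∀ {p q r} → p ≋ q → q ≋ r → p ≋ r
  ≋-trans e f = mk≋ λ i → R.trans (coeff≈ e i) (coeff≈ f i)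

  private
    infixr 2 _⟫_
    _⟫_ : ∀ {p q r} → p ≋ q → q ≋ r → p ≋ r
    _⟫_ = ≋-trans

  ∷-cong : ∀ {a b p q} → a ≈ b → p ≋ q → (a ∷ p) ≋ (b ∷ q)
  ∷-cong a≈b e = mk≋ λ { zero → a≈b ; (suc i) → coeff≈ e i }

  ⊕-cong : ∀ {p p′ q q′} → p ≋ p′ → q ≋ q′ → p ⊕ q ≋ p′ ⊕ q′
  ⊕-cong {p} {p′} {q} {q′} e f = mk≋ λ i → begin
    coeff (p ⊕ q) i            ≈⟨ coeff-⊕ p q i ⟩
    coeff p i + coeff q i      ≈⟨ R.+-cong (coeff≈ e i) (coeff≈ f i) ⟩
    coeff p′ i + coeff q′ i    ≈⟨ coeff-⊕ p′ q′ i ⟨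
    coeff (p′ ⊕ q′) i          ∎

  ⊕-comm : ∀ p q → p ⊕ q ≋ q ⊕ p
  ⊕-comm p q = mk≋ λ i → begin
    coeff (p ⊕ q) i            ≈⟨ coeff-⊕ p q i ⟩
    coeff p i + coeff q i      ≈⟨ R.+-comm _ _ ⟩
    coeff q i + coeff p i      ≈⟨ coeff-⊕ q p i ⟨
    coeff (q ⊕ p) i            ∎

  ⊕-assoc : ∀ p q r → (p ⊕ q) ⊕ r ≋ p ⊕ (q ⊕ r)
  ⊕-assoc p q r = mk≋ λ i → begin
    coeff ((p ⊕ q) ⊕ r) i                  ≈⟨ coeff-⊕ (p ⊕ q) r i ⟩
    coeff (p ⊕ q) i + coeff r i            ≈⟨ R.+-congʳ (coeff-⊕ p q i) ⟩
    (coeff p i + coeff q i) + coeff r i    ≈⟨ R.+-assoc _ _ _ ⟩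
    coeff p i + (coeff q i + coeff r i)    ≈⟨ R.+-congˡ (coeff-⊕ q r i) ⟨
    coeff p i + coeff (q ⊕ r) i            ≈⟨ coeff-⊕ p (q ⊕ r) i ⟨
    coeff (p ⊕ (q ⊕ r)) i                  ∎

  ⊕-identityʳ : ∀ p → p ⊕ [] ≋ p
  ⊕-identityʳ []      = ≋-refl
  ⊕-identityʳ (a ∷ p) = ≋-refl

  ⊖-cong : ∀ {p q} → p ≋ q → ⊖ p ≋ ⊖ q
  ⊖-cong {p} {q} e = mk≋ λ i → begin
    coeff (⊖ p) i    ≈⟨ coeff-⊖ p i ⟩
    - coeff p i      ≈⟨ R.-‿cong (coeff≈ e i) ⟩
    - coeff q i      ≈⟨ coeff-⊖ q i ⟨
    coeff (⊖ q) i    ∎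

  ⊖-inverseʳ : ∀ p → p ⊕ ⊖ p ≋ []
  ⊖-inverseʳ p = mk≋ λ i → begin
    coeff (p ⊕ ⊖ p) i            ≈⟨ coeff-⊕ p (⊖ p) i ⟩
    coeff p i + coeff (⊖ p) i    ≈⟨ R.+-congˡ (coeff-⊖ p i) ⟩
    coeff p i + - coeff p i      ≈⟨ R.-‿inverseʳ _ ⟩
    0#                           ∎

  ⊕-interchange : ∀ p q r s → (p ⊕ q) ⊕ (r ⊕ s) ≋ (p ⊕ r) ⊕ (q ⊕ s)
  ⊕-interchange p q r s = mk≋ λ i → begin
    coeff ((p ⊕ q) ⊕ (r ⊕ s)) i                          ≈⟨ expand p q r s i ⟩
    (coeff p i + coeff q i) + (coeff r i + coeff s i)    ≈⟨ interchange _ _ _ _ ⟩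
    (coeff p i + coeff r i) + (coeff q i + coeff s i)    ≈⟨ expand p r q s i ⟨
    coeff ((p ⊕ r) ⊕ (q ⊕ s)) i                          ∎
    where
    expand : ∀ p q r s i → coeff ((p ⊕ q) ⊕ (r ⊕ s)) i ≈
             (coeff p i + coeff q i) + (coeff r i + coeff s i)
    expand p q r s i =
      R.trans (coeff-⊕ (p ⊕ q) (r ⊕ s) i) (R.+-cong (coeff-⊕ p q i) (coeff-⊕ r s i))

  ·-cong : ∀ {a b p q} → a ≈ b → p ≋ q → a · p ≋ b · q
  ·-cong {a} {b} {p} {q} a≈b e = mk≋ λ i → begin
    coeff (a · p) i    ≈⟨ coeff-· a p i ⟩
    a * coeff p i      ≈⟨ R.*-cong a≈b (coeff≈ e i) ⟩
    b * coeff q i      ≈⟨ coeff-· b q i ⟨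
    coeff (b · q) i    ∎

  ·-distribˡ : ∀ a p q → a · (p ⊕ q) ≋ a · p ⊕ a · q
  ·-distribˡ a p q = mk≋ λ i → begin
    coeff (a · (p ⊕ q)) i                  ≈⟨ coeff-· a (p ⊕ q) i ⟩
    a * coeff (p ⊕ q) i                    ≈⟨ R.*-congˡ (coeff-⊕ p q i) ⟩
    a * (coeff p i + coeff q i)            ≈⟨ R.distribˡ _ _ _ ⟩
    a * coeff p i + a * coeff q i          ≈⟨ R.+-cong (coeff-· a p i) (coeff-· a q i) ⟨
    coeff (a · p) i + coeff (a · q) i      ≈⟨ coeff-⊕ (a · p) (a · q) i ⟨
    coeff (a · p ⊕ a · q) i                ∎

  ·-distribʳ : ∀ a b p → (a + b) · p ≋ a · p ⊕ b · p
  ·-distribʳ a b p = mk≋ λ i → begin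
    coeff ((a + b) · p) i                  ≈⟨ coeff-· (a + b) p i ⟩
    (a + b) * coeff p i                    ≈⟨ R.distribʳ _ _ _ ⟩
    a * coeff p i + b * coeff p i          ≈⟨ R.+-cong (coeff-· a p i) (coeff-· b p i) ⟨
    coeff (a · p) i + coeff (b · p) i      ≈⟨ coeff-⊕ (a · p) (b · p) i ⟨
    coeff (a · p ⊕ b · p) i                ∎

  ·-· : ∀ a b p → a · (b · p) ≋ (a * b) · p
  ·-· a b p = mk≋ λ i → begin
    coeff (a · (b · p)) i    ≈⟨ coeff-· a (b · p) i ⟩
    a * coeff (b · p) i      ≈⟨ R.*-congˡ (coeff-· b p i) ⟩
    a * (b * coeff p i)      ≈⟨ R.*-assoc _ _ _ ⟨
    (a * b) * coeff p i      ≈⟨ coeff-· (a * b) p i ⟨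
    coeff ((a * b) · p) i    ∎

  0·  : ∀ p → 0# · p ≋ []
  0· p = mk≋ λ i → R.trans (coeff-· 0# p i) (R.zeroˡ _)

  1· : ∀ p → 1# · p ≋ p
  1· p = mk≋ λ i → R.trans (coeff-· 1# p i) (R.*-identityˡ _)

  0∷[] : (0# ∷ []) ≋ []
  0∷[] = mk≋ λ { zero → R.refl ; (suc i) → R.refl }

  ⊛-zeroʳ : ∀ p → p ⊛ [] ≋ []
  ⊛-zeroʳ []      = ≋-refl
  ⊛-zeroʳ (a ∷ p) = ∷-cong R.refl (⊛-zeroʳ p) ⟫ 0∷[]

  ⊛-congˡ : ∀ p {q q′} → q ≋ q′ → p ⊛ q ≋ p ⊛ q′
  ⊛-congˡ []      e = ≋-refl
  ⊛-congˡ (a ∷ p) e = ⊕-cong (·-cong R.refl e) (∷-cong R.refl (⊛-congˡ p e))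

  ⊛-∷ : ∀ p b q → p ⊛ (b ∷ q) ≋ b · p ⊕ (0# ∷ (p ⊛ q))
  ⊛-∷ []      b q = ≋-sym 0∷[]
  ⊛-∷ (a ∷ p) b q = ∷-cong (R.+-congʳ (R.*-comm a b))
    (⊕-cong ≋-refl (⊛-∷ p b q) ⟫
     ≋-sym (⊕-assoc (a · q) (b · p) _) ⟫
     ⊕-cong (⊕-comm (a · q) (b · p)) ≋-refl ⟫
     ⊕-assoc (b · p) (a · q) _)

  ⊛-comm : ∀ p q → p ⊛ q ≋ q ⊛ p
  ⊛-comm []      q = ≋-sym (⊛-zeroʳ q)
  ⊛-comm (a ∷ p) q = ⊕-cong ≋-refl (∷-cong R.refl (⊛-comm p q)) ⟫ ≋-sym (⊛-∷ q a p)

  ⊛-cong : ∀ {p p′ q q′} → p ≋ p′ → q ≋ q′ → p ⊛ q ≋ p′ ⊛ q′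
  ⊛-cong {p} {p′} {q} {q′} e f =
    ⊛-congˡ p f ⟫ ⊛-comm p q′ ⟫ ⊛-congˡ q′ e ⟫ ⊛-comm q′ p′

  ⊛-distribʳ : ∀ r p q → (p ⊕ q) ⊛ r ≋ p ⊛ r ⊕ q ⊛ r
  ⊛-distribʳ r []      q       = ≋-refl
  ⊛-distribʳ r (a ∷ p) []      = ≋-sym (⊕-identityʳ _)
  ⊛-distribʳ r (a ∷ p) (b ∷ q) =
    ⊕-cong (·-distribʳ a b r)
           (∷-cong (R.sym (R.+-identityˡ 0#)) (⊛-distribʳ r p q)) ⟫
    ⊕-interchange (a · r) (b · r) (0# ∷ (p ⊛ r)) (0# ∷ (q ⊛ r))

  ⊛-distribˡ : ∀ r p q → r ⊛ (p ⊕ q) ≋ r ⊛ p ⊕ r ⊛ q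
  ⊛-distribˡ r p q =
    ⊛-comm r (p ⊕ q) ⟫ ⊛-distribʳ r p q ⟫ ⊕-cong (⊛-comm p r) (⊛-comm q r)

  ·-⊛ : ∀ a p q → (a · p) ⊛ q ≋ a · (p ⊛ q)
  ·-⊛ a []      q = ≋-refl
  ·-⊛ a (b ∷ p) q =
    ⊕-cong (≋-sym (·-· a b q)) (∷-cong (R.sym (R.zeroʳ a)) (·-⊛ a p q)) ⟫
    ≋-sym (·-distribˡ a (b · q) (0# ∷ (p ⊛ q)))

  0∷-⊛ : ∀ p q → (0# ∷ p) ⊛ q ≋ 0# ∷ (p ⊛ q)
  0∷-⊛ p q = ⊕-cong (0· q) ≋-refl

  ⊛-assoc : ∀ p q r → (p ⊛ q) ⊛ r ≋ p ⊛ (q ⊛ r)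
  ⊛-assoc []      q r = ≋-refl
  ⊛-assoc (a ∷ p) q r =
    ⊛-distribʳ r (a · q) (0# ∷ (p ⊛ q)) ⟫
    ⊕-cong (·-⊛ a q r) (0∷-⊛ (p ⊛ q) r ⟫ ∷-cong R.refl (⊛-assoc p q r))

  ⊛-identityˡ : ∀ p → const 1# ⊛ p ≋ p
  ⊛-identityˡ p = ⊕-cong (1· p) 0∷[] ⟫ ⊕-identityʳ p

  polynomialRing : CommutativeRing c ℓ
  polynomialRing = record
    { Carrier = Poly
    ; _≈_ = _≋_
    ; _+_ = _⊕_
    ; _*_ = _⊛_
    ; -_ = ⊖_
    ; 0# = []
    ; 1# = const 1#
    ; isCommutativeRing = record
      { isRing = record
        { +-isAbelianGroup = record
          { isGroup = record
            { isMonoid = record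
              { isSemigroup = record
                { isMagma = record
                  { isEquivalence = record
                    { refl = ≋-refl ; sym = ≋-sym ; trans = ≋-trans }
                  ; ∙-cong = ⊕-cong }
                ; assoc = ⊕-assoc }
              ; identity = (λ p → ≋-refl) , ⊕-identityʳ }
            ; inverse = (λ p → ⊕-comm (⊖ p) p ⟫ ⊖-inverseʳ p) , ⊖-inverseʳ
            ; ⁻¹-cong = ⊖-cong }
          ; comm = ⊕-comm }
        ; *-cong = ⊛-cong
        ; *-assoc = ⊛-assoc
        ; *-identity = ⊛-identityˡ , λ p → ⊛-comm p (const 1#) ⟫ ⊛-identityˡ p
        ; distrib = ⊛-distribˡ , ⊛-distribʳ }
      ; *-comm = ⊛-comm } }

-- K[x,y] is built as (K[x])[y].
module Bivariate {c ℓ} (K : CommutativeRing c ℓ) where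

  private
    K[x] : CommutativeRing c ℓ
    K[x] = Polynomial.polynomialRing K

    module Px = Polynomial K
    module Py = Polynomial K[x]

  K[x,y] : CommutativeRing c ℓ
  K[x,y] = Py.polynomialRing

  scalar : CommutativeRing.Carrier K → CommutativeRing.Carrier K[x,y]
  scalar a = Py.const (Px.const a)

  x y : CommutativeRing.Carrier K[x,y]
  x = Py.const Px.X
  y = Py.X

------------------------------------------------------------------------
-- Roots of unity

-- Over a ring with zero divisors, asking only that ξ ^ k ≉ 1# for 0 < k < n
-- is too weak to be a notion of primitivity: 3 ∈ ℤ/8 has multiplicative
-- order 2, yet (1 - X)(1 - 3X) ≠ 1 - X².  The differences ξ ^ k - 1 are
-- required to be non-zero-divisors; in an integral domain this says exactly
-- that ξ has multiplicative order n.

record IsPrimitiveRoot {c ℓ} (K : CommutativeRing c ℓ) (n : ℕ)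
                       (ξ : CommutativeRing.Carrier K) : Set (c ⊔ ℓ) where
  open CommutativeRing K
  open RawSemiringDefs (Semiring.rawSemiring semiring) using (_^_)
  field
    ξ^n≈1   : ξ ^ n ≈ 1#
    regular : ∀ k → 0 < k → k < n → ∀ a → (ξ ^ k - 1#) * a ≈ 0# → a ≈ 0#

------------------------------------------------------------------------
-- Matroids

-- The ground set is a subset E of an ambient Fin m, so that restrictions and
-- contractions live on actual subsets of E.  The values of rk on sets not
-- contained in E are unconstrained and never used.

record Matroid (m : ℕ) : Set where
  field
    E          : Subset m
    rk         : Subset m → ℕ
    rk≤∣∣      : ∀ A → A ⊆ E → rk A ≤ ∣ A ∣
    monotone   : ∀ A B → A ⊆ B → B ⊆ E → rk A ≤ rk B
    submodular : ∀ A B → A ⊆ E → B ⊆ E →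
                 rk (A ∪ B) ℕ.+ rk (A ∩ B) ≤ rk A ℕ.+ rk B

  rank corank : ℕ
  rank   = rk E
  corank = ∣ E ∣ ∸ rank

open Matroid public using (rank; corank)

private
  ∪-⊆ : ∀ {m} {A B C : Subset m} → A ⊆ C → B ⊆ C → A ∪ B ⊆ C
  ∪-⊆ {A = A} {B} A⊆C B⊆C x∈ with Sub.x∈p∪q⁻ A B x∈
  ... | inj₁ x∈A = A⊆C x∈A
  ... | inj₂ x∈B = B⊆C x∈B

  ∪-monoʳ : ∀ {m} (A : Subset m) {B C} → B ⊆ C → A ∪ B ⊆ A ∪ C
  ∪-monoʳ A {B} {C} B⊆C =
    ∪-⊆ {A = A} {B} (Sub.p⊆p∪q C) (λ x∈B → Sub.q⊆p∪q A C (B⊆C x∈B))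

  ∸-pairs : ∀ {a b c d} r → r ≤ a → r ≤ b → r ≤ c → r ≤ d →
            a ℕ.+ b ≤ c ℕ.+ d → (a ∸ r) ℕ.+ (b ∸ r) ≤ (c ∸ r) ℕ.+ (d ∸ r)
  ∸-pairs {a} {b} {c} {d} r ra rb rc rd h = begin
    (a ∸ r) ℕ.+ (b ∸ r)  ≡⟨ split a b ra rb ⟨
    (a ℕ.+ b) ∸ r ∸ r    ≤⟨ ℕₚ.∸-monoˡ-≤ r (ℕₚ.∸-monoˡ-≤ r h) ⟩
    (c ℕ.+ d) ∸ r ∸ r    ≡⟨ split c d rc rd ⟩
    (c ∸ r) ℕ.+ (d ∸ r)  ∎
    where
    open ℕₚ.≤-Reasoning
    split : ∀ s t → r ≤ s → r ≤ t → (s ℕ.+ t) ∸ r ∸ r ≡ (s ∸ r) ℕ.+ (t ∸ r)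
    split s t rs rt = ≡.trans
      (cong (_∸ r) (ℕₚ.+-∸-assoc s rt))
      (ℕₚ.+-∸-comm (t ∸ r) rs)

-- M | A
restrict : ∀ {m} (M : Matroid m) (A : Subset m) → A ⊆ Matroid.E M → Matroid m
restrict M A A⊆E = record
  { E          = A
  ; rk         = rk
  ; rk≤∣∣      = λ B B⊆A → rk≤∣∣ B (λ x → A⊆E (B⊆A x))
  ; monotone   = λ B C B⊆C C⊆A → monotone B C B⊆C (λ x → A⊆E (C⊆A x))
  ; submodular = λ B C B⊆A C⊆A → submodular B C (λ x → A⊆E (B⊆A x)) (λ x → A⊆E (C⊆A x))
  }
  where open Matroid M

-- M / A
contract : ∀ {m} (M : Matroid m) (A : Subset m) → A ⊆ Matroid.E M → Matroid m
contract {m} M A A⊆E = record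
  { E          = E ─ A
  ; rk         = λ B → rk (A ∪ B) ∸ rk A
  ; rk≤∣∣      = λ B B⊆ → ℕₚ.m≤n+o⇒m∸n≤o (rk (A ∪ B)) (rk A) (begin
      rk (A ∪ B)                   ≤⟨ ℕₚ.m≤m+n _ _ ⟩
      rk (A ∪ B) ℕ.+ rk (A ∩ B)    ≤⟨ submodular A B A⊆E (lower B⊆) ⟩
      rk A ℕ.+ rk B                ≤⟨ ℕₚ.+-monoʳ-≤ (rk A) (rk≤∣∣ B (lower B⊆)) ⟩
      rk A ℕ.+ ∣ B ∣               ∎)
  ; monotone   = λ B C B⊆C C⊆ → ℕₚ.∸-monoˡ-≤ (rk A)
      (monotone (A ∪ B) (A ∪ C) (∪-monoʳ A B⊆C) (∪-⊆ {A = A} A⊆E (lower C⊆)))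
  ; submodular = λ B C B⊆ C⊆ →
      let B⊆E : B ⊆ E
          B⊆E = lower B⊆
          C⊆E : C ⊆ E
          C⊆E = lower C⊆
          B∩C⊆E : B ∩ C ⊆ E
          B∩C⊆E = λ x∈ → B⊆E (Sub.p∩q⊆p B C x∈)
      in ∸-pairs (rk A)
           (above (B ∪ C) (∪-⊆ {A = B} B⊆E C⊆E)) (above (B ∩ C) B∩C⊆E)
           (above B B⊆E) (above C C⊆E)
           (subst₂ (λ S T → rk S ℕ.+ rk T ≤ rk (A ∪ B) ℕ.+ rk (A ∪ C))
             (∪-∪ B C) (≡.sym (Sub.∪-distribˡ-∩ A B C))
             (submodular (A ∪ B) (A ∪ C)
               (∪-⊆ {A = A} A⊆E B⊆E) (∪-⊆ {A = A} A⊆E C⊆E)))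
  }
  where
  open Matroid M
  open ℕₚ.≤-Reasoning

  lower : ∀ {B} → B ⊆ E ─ A → B ⊆ E
  lower B⊆ x∈B = Sub.p─q⊆p E A (B⊆ x∈B)

  above : ∀ B → B ⊆ E → rk A ≤ rk (A ∪ B)
  above B B⊆E = monotone A (A ∪ B) (Sub.p⊆p∪q B) (∪-⊆ {A = A} A⊆E B⊆E)

  ∪-∪ : ∀ B C → (A ∪ B) ∪ (A ∪ C) ≡ A ∪ (B ∪ C)
  ∪-∪ B C = ≡.trans (Sub.∪-assoc A B (A ∪ C)) (≡.trans
    (cong (A ∪_) (≡.trans (≡.sym (Sub.∪-assoc B A C))
      (≡.trans (cong (_∪ C) (Sub.∪-comm B A)) (Sub.∪-assoc A B C))))
    (≡.trans (≡.sym (Sub.∪-assoc A A (B ∪ C))) (cong (_∪ (B ∪ C)) (Sub.∪-idem A))))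

------------------------------------------------------------------------
-- Enumerations

subsets : ∀ m → List (Subset m)
subsets zero    = [] ∷ []
subsets (suc m) = cartesianProductWith _∷_ (inside ∷ outside ∷ []) (subsets m)

subsetsOf : ∀ {m} → Subset m → List (Subset m)
subsetsOf E = filter (_⊆? E) (subsets _)

tuples : ∀ {a} {A : Set a} → List A → ∀ k → List (Vector A k)
tuples xs zero    = Vector.[] ∷ []
tuples xs (suc k) = cartesianProductWith Vector._∷_ xs (tuples xs k)

record IsChain {m} (E : Subset m) (n : ℕ) (A : Fin (suc n) → Subset m) : Set where
  field
    bottom : A zero ≡ ⊥
    step   : ∀ (i : Fin n) → A (inject₁ i) ⊆ A (suc i)
    top    : A (fromℕ n) ≡ E

isChain? : ∀ {m} (E : Subset m) n (A : Fin (suc n) → Subset m) → Dec (IsChain E n A)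
isChain? E n A = map′
  (λ (b , s , t) → record { bottom = b ; step = s ; top = t })
  (λ c → IsChain.bottom c , IsChain.step c , IsChain.top c)
  (≡-dec _≟ᵇ_ (A zero) ⊥ ×-dec
   all? (λ i → A (inject₁ i) ⊆? A (suc i)) ×-dec
   ≡-dec _≟ᵇ_ (A (fromℕ n)) E)

record Chain {m} (E : Subset m) (n : ℕ) : Set where
  field
    A       : Fin (suc n) → Subset m
    isChain : IsChain E n A
  open IsChain isChain public

  private
    below-top : ∀ n (A : Fin (suc n) → Subset m) →
                (∀ (i : Fin n) → A (inject₁ i) ⊆ A (suc i)) → ∀ i → A i ⊆ A (fromℕ n)
    below-top zero    A s zero    x∈ = x∈
    below-top (suc n) A s zero    x∈ =
      below-top n (λ i → A (suc i)) (λ i → s (suc i)) zero (s zero x∈)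
    below-top (suc n) A s (suc i) x∈ =
      below-top n (λ i → A (suc i)) (λ i → s (suc i)) i x∈

  A⊆E : ∀ i → A i ⊆ E
  A⊆E i {x} x∈ = subst (x ∈_) top (below-top n A step i x∈)

chains : ∀ {m} (E : Subset m) n → List (Chain E n)
chains {m} E n = mapMaybe
  (λ A → Maybe.map (λ c → record { A = A ; isChain = c }) (dec⇒maybe (isChain? E n A)))
  (tuples (subsets m) (suc n))

------------------------------------------------------------------------
-- The Tutte polynomial

module RingExpressions {c ℓ} (R : CommutativeRing c ℓ) where
  open CommutativeRing R public
  open RawSemiringDefs (Semiring.rawSemiring semiring) public using (_^_; product)

  ∑ : ∀ {a} {A : Set a} → List A → (A → Carrier) → Carrier
  ∑ xs f = foldr (λ x s → f x + s) 0# xs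

  -- The value 𝔗_M(x, y) at elements x, y of R.  Both truncated subtractions
  -- are exact, by monotonicity of rk and rk A ≤ ∣ A ∣.
  tutte : ∀ {m} → Matroid m → Carrier → Carrier → Carrier
  tutte M x y = ∑ (subsetsOf E) λ A →
    (x - 1#) ^ (rank M ∸ rk A) * (y - 1#) ^ (∣ A ∣ ∸ rk A)
    where open Matroid M using (E; rk)

-- M / Aᵢ, M | Aᵢ₋₁ and M | Aᵢ / Aᵢ₋₁ for a chain ∅ = A₀ ⊆ ⋯ ⊆ Aₙ = E(M).
-- The index 1 ≤ i ≤ n is represented by j = i - 1 : Fin n, so that
-- Aᵢ₋₁ = A (inject₁ j) and Aᵢ = A (suc j).

module ChainMinors {m} (M : Matroid m) {n} (C : Chain (Matroid.E M) n) (j : Fin n) where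
  open Chain C

  contraction restriction subquotient : Matroid m
  contraction = contract M (A (suc j)) (A⊆E (suc j))
  restriction = restrict M (A (inject₁ j)) (A⊆E (inject₁ j))
  subquotient = contract (restrict M (A (suc j)) (A⊆E (suc j))) (A (inject₁ j)) (step j)

{-# OPTIONS --safe #-}

-- Put xᵢ = ξⁱ⁻¹ x and yᵢ = ξⁱ⁻¹ y, and sum the i-th Tutte polynomial over sets Bᵢ with
-- Aᵢ₋₁ ⊆ Bᵢ ⊆ Aᵢ.  The exponents telescope: the i-th factor becomes
-- (1 - xᵢ)^(rk E - rk Bᵢ) (1 - yᵢ)^(|Bᵢ| - rk Bᵢ) times a sign, and after collecting signs the
-- sum over Aᵢ for Bᵢ ⊆ Aᵢ ⊆ Bᵢ₊₁ is an alternating sum (-1)^|Aᵢ|, which vanishes unless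
-- Bᵢ = Bᵢ₊₁.  So all Bᵢ coincide, and the right-hand side is a single sum over B, in which
-- ∏ᵢ (1 - ξⁱ⁻¹ x) = 1 - xⁿ gives the left-hand side.
--
-- That product formula uses only that it is invariant under x ↦ ξ x: its k-th coefficient c
-- satisfies ξᵏ c = c, so c = 0 for 0 < k < n by regularity, and since the product vanishes at
-- x = 1, the top coefficient is -1.

module Submission where

open import Defs
open import Algebra.Bundles using (CommutativeRing)
import Algebra.Properties.CommutativeSemigroup as CommutativeSemigroupProperties
import Algebra.Properties.CommutativeSemiring.Exp as CommutativeExp
import Algebra.Properties.Ring as RingProperties
import Algebra.Properties.Semiring.Exp as Exp
import Algebra.Solver.Ring.NaturalCoefficients.Default as SemiringSolver
open import Data.Bool using (true; false; if_then_else_)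
open import Data.Bool.Properties using () renaming (_≟_ to _≟ᵇ_)
open import Data.Empty using (⊥-elim)
open import Data.Fin using (Fin; zero; suc; toℕ; fromℕ; inject₁)
open import Data.Fin.Properties using (all?)
open import Data.Fin.Subset using (Subset; inside; outside; ⊥; _⊆_; _∪_; _─_; ∣_∣)
open import Data.Fin.Subset.Properties as Subset using (_⊆?_; drop-∷-⊆)
open import Data.List using (List; []; _∷_; _++_; map; filter; mapMaybe; cartesianProductWith)
open import Data.Maybe as Maybe using (Maybe; just; nothing; maybe′)
open import Data.Nat as ℕ using (ℕ; zero; suc; NonZero; _∸_; _≤_; _<_; s≤s; s<s; z<s)
import Data.Nat.Properties as ℕₚ
open import Data.Vec using ([]; _∷_; here)
open import Data.Vec.Functional as Vector using (Vector)
open import Data.Vec.Properties using (≡-dec)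
open import Relation.Binary.Definitions using (DecidableEquality)
open import Relation.Binary.PropositionalEquality as ≡ using (_≡_)
import Relation.Binary.Reasoning.Setoid as SetoidReasoning
open import Relation.Nullary using (Dec; yes; no; does)
open import Relation.Nullary.Decidable using (_×-dec_; dec⇒maybe)
open import Relation.Nullary.Negation using (¬_; contradiction)
open import Relation.Unary using (Pred; Decidable)

-- Finite products in a commutative ring.

module FiniteProducts {c ℓ} (R : CommutativeRing c ℓ) where
  open RingExpressions R hiding (zero)
  open CommutativeSemigroupProperties *-commutativeSemigroup using (interchange)
  open CommutativeExp commutativeSemiring using (^-distrib-*)

  product-cong : ∀ n {f g : Fin n → Carrier} → (∀ j → f j ≈ g j) → product f ≈ product g
  product-cong zero    f≈g = refl
  product-cong (suc n) f≈g = *-cong (f≈g zero) (product-cong n λ j → f≈g (suc j))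

  product-* : ∀ n (f g : Fin n → Carrier) →
              product (λ j → f j * g j) ≈ product f * product g
  product-* zero    f g = sym (*-identityˡ 1#)
  product-* (suc n) f g = trans
    (*-congˡ (product-* n (λ j → f (suc j)) (λ j → g (suc j)))) (interchange _ _ _ _)

  1^ : ∀ k → 1# ^ k ≈ 1#
  1^ zero    = refl
  1^ (suc k) = trans (*-identityˡ _) (1^ k)

  product-^ : ∀ n (f : Fin n → Carrier) k → product (λ j → f j ^ k) ≈ product f ^ k
  product-^ zero    f k = sym (1^ k)
  product-^ (suc n) f k = trans (*-congˡ (product-^ n (λ j → f (suc j)) k))
    (sym (^-distrib-* _ _ k))

-- The factorisation of `1 - z ^ n` over a primitive root of unity.

module RootsOfUnity {c ℓ} (R : CommutativeRing c ℓ) where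
  open RingExpressions R hiding (zero)
  open SetoidReasoning setoid
  open RingProperties ring using (-‿distribʳ-*; +-cancelʳ; -1*x≈-x; +-inverseʳ-unique)
  open SemiringSolver commutativeSemiring using (solve; _:+_; _:*_; _:=_; con)
  open FiniteProducts R using (product-cong; 1^)

  -- Horner evaluation at `z`; `N` counts the coefficients used, so the degree is below `N`. With
  -- coefficients given by a function, shifts and dilations are plain lambda terms.
  ev : (ℕ → Carrier) → ℕ → Carrier → Carrier
  ev f zero    z = 0#
  ev f (suc N) z = f 0 + z * ev (λ k → f (suc k)) N z

  ev-cong : ∀ {f g} N z → (∀ k → f k ≈ g k) → ev f N z ≈ ev g N z
  ev-cong zero    z f≈g = refl
  ev-cong (suc N) z f≈g = +-cong (f≈g 0) (*-congˡ (ev-cong N z λ k → f≈g (suc k)))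

  ev-+* : ∀ f g a N z → ev (λ k → f k + a * g k) N z ≈ ev f N z + a * ev g N z
  ev-+* f g a zero    z = sym (trans (+-identityˡ _) (zeroʳ a))
  ev-+* f g a (suc N) z = begin
    f 0 + a * g 0 + z * ev _ N z
      ≈⟨ +-congˡ (*-congˡ (ev-+* (λ k → f (suc k)) (λ k → g (suc k)) a N z)) ⟩
    f 0 + a * g 0 + z * (F + a * G)
      ≈⟨ solve 6 (λ f₀ g₀ a z F G → f₀ :+ a :* g₀ :+ z :* (F :+ a :* G) :=
                  f₀ :+ z :* F :+ a :* (g₀ :+ z :* G)) refl (f 0) (g 0) a z F G ⟩
    f 0 + z * F + a * (g 0 + z * G) ∎
    where
    F = ev (λ k → f (suc k)) N z
    G = ev (λ k → g (suc k)) N z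

  ev-dilate : ∀ a f N z → ev (λ k → a ^ k * f k) N z ≈ ev f N (a * z)
  ev-dilate a f zero    z = refl
  ev-dilate a f (suc N) z = begin
    1# * f 0 + z * ev (λ k → a * a ^ k * f (suc k)) N z
      ≈⟨ +-cong (*-identityˡ _) (*-congˡ (ev-cong N z λ k →
           trans (*-assoc _ _ _) (sym (+-identityˡ _)))) ⟩
    -- The summand `0#` brings the coefficients into the form of `ev-+*`, which then pulls out one
    -- factor `a`.
    f 0 + z * ev (λ k → 0# + a * (a ^ k * f (suc k))) N z
      ≈⟨ +-congˡ (*-congˡ (ev-+* (λ _ → 0#) _ a N z)) ⟩
    f 0 + z * (ev (λ _ → 0#) N z + a * ev (λ k → a ^ k * f (suc k)) N z)
      ≈⟨ +-congˡ (*-congˡ (trans (+-congʳ (ev-0 N)) (+-identityˡ _))) ⟩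
    f 0 + z * (a * ev (λ k → a ^ k * f (suc k)) N z)
      ≈⟨ +-congˡ (trans (sym (*-assoc _ _ _)) (*-cong (*-comm z a) (ev-dilate a (λ k → f (suc k)) N z))) ⟩
    f 0 + a * z * ev (λ k → f (suc k)) N (a * z) ∎
    where
    ev-0 : ∀ N → ev (λ _ → 0#) N z ≈ 0#
    ev-0 zero    = refl
    ev-0 (suc N) = trans (+-identityˡ _) (trans (*-congˡ (ev-0 N)) (zeroʳ z))

  ev-top : ∀ f N z → f N ≈ 0# → ev f (suc N) z ≈ ev f N z
  ev-top f zero    z fN≈0 = trans (+-cong fN≈0 (zeroʳ z)) (+-identityˡ 0#)
  ev-top f (suc N) z fN≈0 = +-congˡ (*-congˡ (ev-top (λ k → f (suc k)) N z fN≈0))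

  ev-monomial : ∀ f N z → (∀ k → k < N → f k ≈ 0#) → ev f (suc N) z ≈ f N * z ^ N
  ev-monomial f zero    z _   = trans (+-congˡ (zeroʳ z))
                                  (trans (+-identityʳ _) (sym (*-identityʳ _)))
  ev-monomial f (suc N) z f≈0 = begin
    f 0 + z * ev (λ k → f (suc k)) (suc N) z
      ≈⟨ +-cong (f≈0 0 z<s) (*-congˡ (ev-monomial _ N z λ k k<N → f≈0 (suc k) (s<s k<N))) ⟩
    0# + z * (f (suc N) * z ^ N)
      ≈⟨ solve 3 (λ z a b → con 0 :+ z :* (a :* b) := a :* (z :* b)) refl z (f (suc N)) (z ^ N) ⟩
    f (suc N) * (z * z ^ N) ∎

  -- Signed q-binomial coefficients: the coefficient of zᵏ in ∏_{j<n} (1 + μ ζʲ z),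
  -- computed by splitting off the factor j = 0.
  qcoeff : Carrier → Carrier → ℕ → ℕ → Carrier
  qcoeff ζ μ zero    zero    = 1#
  qcoeff ζ μ zero    (suc k) = 0#
  qcoeff ζ μ (suc n) zero    = qcoeff ζ μ n zero
  qcoeff ζ μ (suc n) (suc k) = ζ ^ suc k * qcoeff ζ μ n (suc k) + μ * (ζ ^ k * qcoeff ζ μ n k)

  module _ (ζ μ : Carrier) where

    private q = qcoeff ζ μ

    qcoeff-zero : ∀ n → q n 0 ≈ 1#
    qcoeff-zero zero    = refl
    qcoeff-zero (suc n) = qcoeff-zero n

    qcoeff-above : ∀ n k → n < k → q n k ≈ 0#
    qcoeff-above zero    (suc k) _         = refl
    qcoeff-above (suc n) (suc k) (s≤s n<k) = begin
      ζ ^ suc k * q n (suc k) + μ * (ζ ^ k * q n k)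
        ≈⟨ +-cong (*-congˡ (qcoeff-above n (suc k) (ℕₚ.m<n⇒m<1+n n<k)))
                  (*-congˡ (*-congˡ (qcoeff-above n k n<k))) ⟩
      ζ ^ suc k * 0# + μ * (ζ ^ k * 0#)
        ≈⟨ solve 3 (λ a b c → a :* con 0 :+ b :* (c :* con 0) := con 0) refl _ _ _ ⟩
      0# ∎

    -- The recursion obtained by splitting off the last factor instead.
    qcoeff-suc : ∀ n k → q (suc n) (suc k) ≈ q n (suc k) + μ * (ζ ^ n * q n k)
    qcoeff-suc zero zero = +-congʳ (zeroʳ _)
    qcoeff-suc zero (suc k) = +-cong (zeroʳ _)
      (*-congˡ (trans (zeroʳ _) (sym (zeroʳ _))))
    qcoeff-suc (suc n) zero = begin
      ζ * 1# * q (suc n) 1 + μ * (1# * q n 0)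
        ≈⟨ +-congʳ (*-congˡ (qcoeff-suc n 0)) ⟩
      ζ * 1# * (q n 1 + μ * (ζ ^ n * q n 0)) + μ * (1# * q n 0)
        ≈⟨ solve 5 (λ ζ μ Z a b →
             ζ :* con 1 :* (a :+ μ :* (Z :* b)) :+ μ :* (con 1 :* b) :=
             ζ :* con 1 :* a :+ μ :* (con 1 :* b) :+ μ :* (ζ :* Z :* b))
             refl ζ μ (ζ ^ n) (q n 1) (q n 0) ⟩
      ζ * 1# * q n 1 + μ * (1# * q n 0) + μ * (ζ * ζ ^ n * q n 0) ∎
    qcoeff-suc (suc n) (suc k) = begin
      ζ * ζ ^ suc k * q (suc n) (suc (suc k)) + μ * (ζ ^ suc k * q (suc n) (suc k))
        ≈⟨ +-cong (*-congˡ (qcoeff-suc n (suc k))) (*-congˡ (*-congˡ (qcoeff-suc n k))) ⟩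
      ζ * ζ ^ suc k * (q n (suc (suc k)) + μ * (ζ ^ n * q n (suc k)))
        + μ * (ζ ^ suc k * (q n (suc k) + μ * (ζ ^ n * q n k)))
        ≈⟨ solve 7 (λ ζ μ Y Z a b d →
             ζ :* (ζ :* Y) :* (a :+ μ :* (Z :* b)) :+ μ :* (ζ :* Y :* (b :+ μ :* (Z :* d))) :=
             ζ :* (ζ :* Y) :* a :+ μ :* (ζ :* Y :* b) :+
             μ :* (ζ :* Z :* (ζ :* Y :* b :+ μ :* (Y :* d))))
             refl ζ μ (ζ ^ k) (ζ ^ n) (q n (suc (suc k))) (q n (suc k)) (q n k) ⟩
      ζ * ζ ^ suc k * q n (suc (suc k)) + μ * (ζ ^ suc k * q n (suc k))
        + μ * (ζ * ζ ^ n * (ζ ^ suc k * q n (suc k) + μ * (ζ ^ k * q n k))) ∎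

    -- Without the factor `j = 0` the product is the one for `n` at `ζ * z`, and this dilation
    -- multiplies the `k`-th coefficient by `ζ ^ k`. Multiplying back by `1# + μ * z` gives the
    -- recursion that defines `qcoeff`.
    product-qcoeff : ∀ n z → product {n} (λ j → 1# + μ * (ζ ^ toℕ j * z)) ≈ ev (q n) (suc n) z
    product-qcoeff zero    z = sym (trans (+-congˡ (zeroʳ z)) (+-identityʳ _))
    product-qcoeff (suc n) z = begin
      (1# + μ * (1# * z)) * product {n} (λ j → 1# + μ * (ζ * ζ ^ toℕ j * z))
        ≈⟨ *-cong (+-congˡ (*-congˡ (*-identityˡ z))) (product-cong n λ j →
             +-congˡ (*-congˡ (solve 3 (λ ζ Z z → ζ :* Z :* z := Z :* (ζ :* z)) refl ζ (ζ ^ toℕ j) z))) ⟩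
      (1# + μ * z) * product {n} (λ j → 1# + μ * (ζ ^ toℕ j * (ζ * z)))
        ≈⟨ *-congˡ (product-qcoeff n (ζ * z)) ⟩
      (1# + μ * z) * ev (q n) (suc n) (ζ * z)
        ≈⟨ *-congˡ (ev-dilate ζ (q n) (suc n) z) ⟨
      (1# + μ * z) * F
        ≈⟨ solve 3 (λ μ z F → (con 1 :+ μ :* z) :* F := F :+ z :* (μ :* F)) refl μ z F ⟩
      F + z * (μ * F)
        -- Appending the vanishing coefficient `f (suc n)` gives `F₊` and `F` equally many terms, so
        -- that they combine coefficientwise.
        ≈⟨ +-congʳ (ev-top f (suc n) z
             (trans (*-congˡ (qcoeff-above n (suc n) ℕₚ.≤-refl)) (zeroʳ _))) ⟨
      1# * q n 0 + z * F₊ + z * (μ * F)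
        ≈⟨ solve 5 (λ a z b μ F → con 1 :* a :+ z :* b :+ z :* (μ :* F) := a :+ z :* (b :+ μ :* F))
             refl (q n 0) z F₊ μ F ⟩
      q n 0 + z * (F₊ + μ * F)
        ≈⟨ +-congˡ (*-congˡ (ev-+* (λ k → f (suc k)) f μ (suc n) z)) ⟨
      q n 0 + z * ev (λ k → q (suc n) (suc k)) (suc n) z ∎
      where
      f : ℕ → Carrier
      f k = ζ ^ k * q n k
      F  = ev f (suc n) z
      F₊ = ev (λ k → f (suc k)) (suc n) z

    -- For ζⁿ = 1 the two recursions agree up to the factor ζᵏ; this expresses
    -- the invariance of the product under z ↦ ζ z.
    qcoeff-invariant : ∀ n → ζ ^ n ≈ 1# → ∀ k → ζ ^ k * q n k ≈ q n k
    qcoeff-invariant n ζⁿ≈1 zero    = *-identityˡ _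
    qcoeff-invariant n ζⁿ≈1 (suc k) = +-cancelʳ (μ * q n k) _ _ (begin
      ζ ^ suc k * q n (suc k) + μ * q n k
        ≈⟨ +-congˡ (*-congˡ (qcoeff-invariant n ζⁿ≈1 k)) ⟨
      q (suc n) (suc k)
        ≈⟨ qcoeff-suc n k ⟩
      q n (suc k) + μ * (ζ ^ n * q n k)
        ≈⟨ +-congˡ (*-congˡ (trans (*-congʳ ζⁿ≈1) (*-identityˡ _))) ⟩
      q n (suc k) + μ * q n k ∎)

  product-roots : ∀ n ζ → IsPrimitiveRoot R (suc n) ζ → ∀ z →
                  product {suc n} (λ j → 1# - ζ ^ toℕ j * z) ≈ 1# - z ^ suc n
  product-roots n ζ prim z = begin
    product {suc n} (λ j → 1# - ζ ^ toℕ j * z)          ≈⟨ expansion z ⟩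
    1# + z * (q (suc n) (suc n) * z ^ n)                ≈⟨ +-congˡ (*-congˡ (*-congʳ leading)) ⟩
    1# + z * (- 1# * z ^ n)                             ≈⟨ +-congˡ (*-congˡ (-1*x≈-x _)) ⟩
    1# + z * - (z ^ n)                                  ≈⟨ +-congˡ (-‿distribʳ-* _ _) ⟨
    1# - z * z ^ n                                      ∎
    where
    open IsPrimitiveRoot prim
    q = qcoeff ζ (- 1#)

    middle : ∀ k → k < n → q (suc n) (suc k) ≈ 0#
    middle k k<n = regular (suc k) z<s (s<s k<n) _ (begin
      (ζ ^ suc k - 1#) * a      ≈⟨ distribʳ _ _ _ ⟩
      ζ ^ suc k * a + - 1# * a  ≈⟨ +-cong (qcoeff-invariant ζ (- 1#) (suc n) ξ^n≈1 (suc k)) (-1*x≈-x _) ⟩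
      a - a                     ≈⟨ -‿inverseʳ _ ⟩
      0#                        ∎)
      where a = q (suc n) (suc k)

    expansion : ∀ z → product {suc n} (λ j → 1# - ζ ^ toℕ j * z) ≈
                      1# + z * (q (suc n) (suc n) * z ^ n)
    expansion z = begin
      product {suc n} (λ j → 1# - ζ ^ toℕ j * z)
        ≈⟨ product-cong (suc n) (λ j → +-congˡ {1#} (-1*x≈-x (ζ ^ toℕ j * z))) ⟨
      product {suc n} (λ j → 1# + - 1# * (ζ ^ toℕ j * z))
        ≈⟨ product-qcoeff ζ (- 1#) (suc n) z ⟩
      q (suc n) 0 + z * ev (λ k → q (suc n) (suc k)) (suc n) z
        ≈⟨ +-cong (qcoeff-zero ζ (- 1#) n) (*-congˡ (ev-monomial _ n z middle)) ⟩
      1# + z * (q (suc n) (suc n) * z ^ n) ∎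

    leading : q (suc n) (suc n) ≈ - 1#
    leading = +-inverseʳ-unique 1# _ (begin
      1# + q (suc n) (suc n)
        ≈⟨ +-congˡ (trans (*-identityˡ _) (trans (*-congˡ (1^ n)) (*-identityʳ _))) ⟨
      1# + 1# * (q (suc n) (suc n) * 1# ^ n)
        ≈⟨ expansion 1# ⟨
      -- The factor `j = 0` at `z = 1`, with `ζ ^ 0 = 1#`.
      (1# - 1# * 1#) * _
        ≈⟨ *-congʳ (trans (+-congˡ (-‿cong (*-identityˡ 1#))) (-‿inverseʳ 1#)) ⟩
      0# * _
        ≈⟨ zeroˡ _ ⟩
      0# ∎)

-- Primitive roots of unity as constant polynomials.

module ConstantPolynomials {c ℓ} (R : CommutativeRing c ℓ) where
  open Polynomial R
  private
    module R = CommutativeRing R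
    module RE = RingExpressions R
    module P = RingExpressions polynomialRing

  const-⊛ : ∀ a p → const a ⊛ p ≋ a · p
  const-⊛ a p = P.trans (⊕-cong (≋-refl {a · p}) 0∷[]) (⊕-identityʳ _)

  const-^ : ∀ a k → const a P.^ k ≋ const (a RE.^ k)
  const-^ a zero    = ≋-refl
  const-^ a (suc k) = P.trans (⊛-congˡ (const a) (const-^ a k)) (const-⊛ a _)

  -- Multiplication by the constant `ζ ^ k - 1#` acts on each coefficient separately, so regularity
  -- is inherited coefficientwise.
  const-isPrimitiveRoot : ∀ {n ζ} → IsPrimitiveRoot R n ζ →
                          IsPrimitiveRoot polynomialRing n (const ζ)
  const-isPrimitiveRoot {n} {ζ} prim = record
    { ξ^n≈1   = P.trans (const-^ ζ n) (∷-cong ξ^n≈1 ≋-refl)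
    ; regular = λ k 0<k k<n p e → mk≋ λ i → regular k 0<k k<n (coeff p i)
        (R.trans (R.sym (coeff-· _ p i)) (coeff≈
          (P.trans (P.sym (P.trans (P.*-congʳ {p} (⊕-cong (const-^ ζ k) (≋-refl {⊖ const R.1#}))) (const-⊛ _ p))) e) i))
    }
    where open IsPrimitiveRoot prim

-- Finite sums and indicators.

module FiniteSums {c ℓ} (R : CommutativeRing c ℓ) where
  open RingExpressions R hiding (zero)
  open SetoidReasoning setoid
  open CommutativeSemigroupProperties +-commutativeSemigroup using (interchange)

  module _ {a} {A : Set a} where

    ∑-cong : ∀ (xs : List A) {f g} → (∀ x → f x ≈ g x) → ∑ xs f ≈ ∑ xs g
    ∑-cong []       f≈g = refl
    ∑-cong (x ∷ xs) f≈g = +-cong (f≈g x) (∑-cong xs f≈g)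

    ∑-0 : ∀ (xs : List A) → ∑ xs (λ _ → 0#) ≈ 0#
    ∑-0 []       = refl
    ∑-0 (x ∷ xs) = trans (+-identityˡ _) (∑-0 xs)

    ∑-zero : ∀ (xs : List A) {f} → (∀ x → f x ≈ 0#) → ∑ xs f ≈ 0#
    ∑-zero xs f≈0 = trans (∑-cong xs f≈0) (∑-0 xs)

    ∑-distrib-+ : ∀ (xs : List A) f g → ∑ xs (λ x → f x + g x) ≈ ∑ xs f + ∑ xs g
    ∑-distrib-+ []       f g = sym (+-identityˡ 0#)
    ∑-distrib-+ (x ∷ xs) f g = trans (+-congˡ (∑-distrib-+ xs f g)) (interchange _ _ _ _)

    *-distribˡ-∑ : ∀ (xs : List A) y f → y * ∑ xs f ≈ ∑ xs (λ x → y * f x)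
    *-distribˡ-∑ []       y f = zeroʳ y
    *-distribˡ-∑ (x ∷ xs) y f = trans (distribˡ _ _ _) (+-congˡ (*-distribˡ-∑ xs y f))

    ∑-++ : ∀ (xs ys : List A) f → ∑ (xs ++ ys) f ≈ ∑ xs f + ∑ ys f
    ∑-++ []       ys f = sym (+-identityˡ _)
    ∑-++ (x ∷ xs) ys f = trans (+-congˡ (∑-++ xs ys f)) (sym (+-assoc _ _ _))

  module _ {a b} {A : Set a} {B : Set b} where

    ∑-comm : ∀ (xs : List A) (ys : List B) (f : A → B → Carrier) →
             ∑ xs (λ x → ∑ ys (f x)) ≈ ∑ ys (λ y → ∑ xs (λ x → f x y))
    ∑-comm []       ys f = sym (∑-0 ys)
    ∑-comm (x ∷ xs) ys f = trans (+-congˡ (∑-comm xs ys f))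
      (sym (∑-distrib-+ ys (f x) _))

    ∑-map : ∀ (g : A → B) xs f → ∑ (map g xs) f ≈ ∑ xs (λ x → f (g x))
    ∑-map g []       f = refl
    ∑-map g (x ∷ xs) f = +-congˡ (∑-map g xs f)

    ∑-mapMaybe : ∀ (p : A → Maybe B) xs f →
                 ∑ (mapMaybe p xs) f ≈ ∑ xs (λ x → maybe′ f 0# (p x))
    ∑-mapMaybe p []       f = refl
    ∑-mapMaybe p (x ∷ xs) f with p x
    ... | just y  = +-congˡ (∑-mapMaybe p xs f)
    ... | nothing = trans (∑-mapMaybe p xs f) (sym (+-identityˡ _))

  ∑-cartesianProductWith :
    ∀ {a b d} {A : Set a} {B : Set b} {D : Set d} (g : A → B → D) xs ys f →
    ∑ (cartesianProductWith g xs ys) f ≈ ∑ xs (λ x → ∑ ys (λ y → f (g x y)))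
  ∑-cartesianProductWith g []       ys f = refl
  ∑-cartesianProductWith g (x ∷ xs) ys f = trans (∑-++ (map (g x) ys) _ f)
    (+-cong (∑-map (g x) ys f) (∑-cartesianProductWith g xs ys f))

  -- Indicators replace filtering, so that summation ranges are independent and sums can be
  -- exchanged. Since only `does` is inspected, the indicator of a compound decision reduces without
  -- its proof component.
  ⟦_⟧ : ∀ {p} {P : Set p} → Dec P → Carrier
  ⟦ P? ⟧ = if does P? then 1# else 0#

  ⟦⟧-*-cong : ∀ {p} {P : Set p} (P? : Dec P) {x y} → (P → x ≈ y) → ⟦ P? ⟧ * x ≈ ⟦ P? ⟧ * y
  ⟦⟧-*-cong (yes p) h = *-congˡ (h p)
  ⟦⟧-*-cong (no _)  h = trans (zeroˡ _) (sym (zeroˡ _))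

  ⟦⟧-×-dec : ∀ {p q} {P : Set p} {Q : Set q} (P? : Dec P) (Q? : Dec Q) →
             ⟦ P? ×-dec Q? ⟧ ≈ ⟦ P? ⟧ * ⟦ Q? ⟧
  ⟦⟧-×-dec (yes _) Q? = sym (*-identityˡ _)
  ⟦⟧-×-dec (no _)  Q? = sym (zeroˡ _)

  ⟦⟧-all? : ∀ {p} n {P : Pred (Fin n) p} (P? : Decidable P) →
            ⟦ all? P? ⟧ ≈ product (λ j → ⟦ P? j ⟧)
  ⟦⟧-all? zero    P? = refl
  ⟦⟧-all? (suc n) P? = trans (⟦⟧-×-dec (P? zero) (all? (λ j → P? (suc j))))
    (*-congˡ (⟦⟧-all? n (λ j → P? (suc j))))

  ∑-filter : ∀ {a p} {A : Set a} {P : Pred A p} (P? : Decidable P) xs f →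
             ∑ (filter P? xs) f ≈ ∑ xs (λ x → ⟦ P? x ⟧ * f x)
  ∑-filter P? []       f = refl
  ∑-filter P? (x ∷ xs) f with does (P? x)
  ... | true  = +-cong (sym (*-identityˡ _)) (∑-filter P? xs f)
  ... | false = trans (∑-filter P? xs f) (sym (trans (+-congʳ (zeroˡ _)) (+-identityˡ _)))

-- Powers of `-1`.

module Signs {c ℓ} (R : CommutativeRing c ℓ) where
  open RingExpressions R hiding (zero)
  open SetoidReasoning setoid
  open RingProperties ring using (-1*x≈-x; -‿involutive; -‿+-comm)
  open Exp semiring using (^-congˡ; ^-congʳ; ^-homo-*)
  open CommutativeExp commutativeSemiring using (^-distrib-*)
  open FiniteProducts R using (1^)

  σ : ℕ → Carrier
  σ k = (- 1#) ^ k

  σ² : ∀ k → σ k * σ k ≈ 1#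
  σ² k = begin
    σ k * σ k            ≈⟨ ^-distrib-* (- 1#) (- 1#) k ⟨
    (- 1# * - 1#) ^ k    ≈⟨ ^-congˡ k (trans (-1*x≈-x _) (-‿involutive 1#)) ⟩
    1# ^ k               ≈⟨ 1^ k ⟩
    1#                   ∎

  -- A sign is its own inverse, so a difference of exponents contributes the same sign as their sum.
  σ-∸ : ∀ {m n} → n ≤ m → σ (m ∸ n) ≈ σ m * σ n
  σ-∸ {m} {n} n≤m = begin
    σ (m ∸ n)                  ≈⟨ *-identityʳ _ ⟨
    σ (m ∸ n) * 1#             ≈⟨ *-congˡ (σ² n) ⟨
    σ (m ∸ n) * (σ n * σ n)    ≈⟨ *-assoc _ _ _ ⟨
    σ (m ∸ n) * σ n * σ n      ≈⟨ *-congʳ (^-homo-* (- 1#) (m ∸ n) n) ⟨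
    σ (m ∸ n ℕ.+ n) * σ n      ≈⟨ *-congʳ (^-congʳ (- 1#) (ℕₚ.m∸n+n≡m n≤m)) ⟩
    σ m * σ n                  ∎

  -- Tutte polynomials involve powers of `z - 1#`, the prefactors powers of `1# - z`; this gives
  -- them a common base.
  ^-flip : ∀ z k → (z - 1#) ^ k ≈ σ k * (1# - z) ^ k
  ^-flip z k = begin
    (z - 1#) ^ k               ≈⟨ ^-congˡ k flip ⟨
    (- 1# * (1# - z)) ^ k      ≈⟨ ^-distrib-* (- 1#) (1# - z) k ⟩
    σ k * (1# - z) ^ k         ∎
    where
    flip : - 1# * (1# - z) ≈ z - 1#
    flip = begin
      - 1# * (1# - z)    ≈⟨ -1*x≈-x _ ⟩
      - (1# - z)         ≈⟨ -‿+-comm 1# (- z) ⟨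
      - 1# + - (- z)     ≈⟨ +-congˡ (-‿involutive z) ⟩
      - 1# + z           ≈⟨ +-comm _ _ ⟩
      z - 1#             ∎

-- Sums over intervals of subsets.

module SubsetSums {c ℓ} (R : CommutativeRing c ℓ) where
  open RingExpressions R hiding (zero)
  open SetoidReasoning setoid
  open FiniteSums R
  open Signs R
  open RingProperties ring using (-1*x≈-x; -‿distribˡ-*; -‿distribʳ-*)

  infix 4 _≟_
  _≟_ : ∀ {m} → DecidableEquality (Subset m)
  _≟_ = ≡-dec _≟ᵇ_

  ∑-subsets : ∀ m (f : Subset (suc m) → Carrier) → ∑ (subsets (suc m)) f ≈
              ∑ (subsets m) (λ B → f (inside ∷ B)) + ∑ (subsets m) (λ B → f (outside ∷ B))
  ∑-subsets m f = trans
    (∑-cartesianProductWith _∷_ (inside ∷ outside ∷ []) (subsets m) f)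
    (+-congˡ (+-identityʳ _))

  ∑-≟ : ∀ {m} (E : Subset m) f → ∑ (subsets m) (λ B → ⟦ B ≟ E ⟧ * f B) ≈ f E
  ∑-≟ []            f = trans (+-identityʳ _) (*-identityˡ _)
  ∑-≟ {suc m} (inside  ∷ E) f = trans (∑-subsets _ (λ B → ⟦ B ≟ inside ∷ E ⟧ * f B)) (trans
    (+-cong (∑-≟ E (λ B → f (inside ∷ B))) (∑-zero (subsets m) λ B → zeroˡ _))
    (+-identityʳ _))
  ∑-≟ {suc m} (outside ∷ E) f = trans (∑-subsets _ (λ B → ⟦ B ≟ outside ∷ E ⟧ * f B)) (trans
    (+-cong (∑-zero (subsets m) λ B → zeroˡ _) (∑-≟ E (λ B → f (outside ∷ B))))
    (+-identityˡ _))

  [_≤_≤_] : ∀ {m} → Subset m → Subset m → Subset m → Carrier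
  [ A ≤ B ≤ C ] = ⟦ A ⊆? B ⟧ * ⟦ B ⊆? C ⟧

  []-cong : ∀ {m} (A B C : Subset m) {x y} → (A ⊆ B → B ⊆ C → x ≈ y) →
            [ A ≤ B ≤ C ] * x ≈ [ A ≤ B ≤ C ] * y
  []-cong A B C h = trans (*-assoc _ _ _) (trans
    (⟦⟧-*-cong (A ⊆? B) λ p → ⟦⟧-*-cong (B ⊆? C) λ q → h p q) (sym (*-assoc _ _ _)))

  ε : ∀ {m} → Subset m → Carrier
  ε A = σ ∣ A ∣

  ε-in : ∀ {m} (B : Subset m) x → x * ε (inside ∷ B) ≈ - (x * ε B)
  ε-in B x = trans (*-congˡ (-1*x≈-x _)) (sym (-‿distribʳ-* _ _))

  ∑-neg : ∀ {a} {A : Set a} (xs : List A) f → ∑ xs (λ x → - f x) ≈ - ∑ xs f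
  ∑-neg xs f = trans (∑-cong xs λ x → sym (-1*x≈-x _))
    (trans (sym (*-distribˡ-∑ xs (- 1#) f)) (-1*x≈-x _))

  -- An element of `C` outside `A` may be toggled in `B`, which reverses the sign and cancels the
  -- sum; an element of `A` outside `C` makes the interval empty. Hence only `C = A` contributes.
  möbius : ∀ {m} (A C : Subset m) →
           ∑ (subsets m) (λ B → [ A ≤ B ≤ C ] * ε B) ≈ ε A * ⟦ C ≟ A ⟧
  möbius {zero} [] [] = trans (+-identityʳ _) (trans (*-identityʳ _) refl)
  möbius {suc m} (a ∷ A) (c ∷ C) =
    trans (∑-subsets m (λ B → [ a ∷ A ≤ B ≤ c ∷ C ] * ε B)) (split a c)
    where
    S : Carrier
    S = ∑ (subsets m) (λ B → [ A ≤ B ≤ C ] * ε B)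

    neg : ∑ (subsets m) (λ B → [ A ≤ B ≤ C ] * ε (inside ∷ B)) ≈ - S
    neg = trans (∑-cong (subsets m) λ B → ε-in B _) (∑-neg (subsets m) _)

    S≈ : S ≈ ε A * ⟦ C ≟ A ⟧
    S≈ = möbius A C

    z₁ : ∀ x y → 0# * x * y ≈ 0#
    z₁ x y = trans (*-congʳ (zeroˡ x)) (zeroˡ y)

    z₂ : ∀ x y → x * 0# * y ≈ 0#
    z₂ x y = trans (*-congʳ (zeroʳ x)) (zeroˡ y)

    split : ∀ a c →
      ∑ (subsets m) (λ B → [ a ∷ A ≤ inside ∷ B ≤ c ∷ C ] * ε (inside ∷ B)) +
      ∑ (subsets m) (λ B → [ a ∷ A ≤ outside ∷ B ≤ c ∷ C ] * ε (outside ∷ B)) ≈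
      ε (a ∷ A) * ⟦ c ∷ C ≟ a ∷ A ⟧
    split inside inside = begin
      _                       ≈⟨ +-cong neg (∑-zero (subsets m) λ B → z₁ _ _) ⟩
      - S + 0#                ≈⟨ +-identityʳ _ ⟩
      - S                     ≈⟨ -‿cong S≈ ⟩
      - (ε A * ⟦ C ≟ A ⟧)     ≈⟨ -‿distribˡ-* _ _ ⟩
      - ε A * ⟦ C ≟ A ⟧       ≈⟨ *-congʳ (-1*x≈-x _) ⟨
      - 1# * ε A * ⟦ C ≟ A ⟧  ∎
    split inside outside = trans
      (+-cong (∑-zero (subsets m) λ B → z₂ _ _) (∑-zero (subsets m) λ B → z₁ _ _))
      (trans (+-identityʳ 0#) (sym (zeroʳ _)))
    split outside inside = trans (+-congʳ neg) (trans (-‿inverseˡ S) (sym (zeroʳ _)))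
    split outside outside = trans
      (+-congʳ (∑-zero (subsets m) λ B → z₂ _ _)) (trans (+-identityˡ S) S≈)

  -- Removing `A` is a bijection from the sets between `A` and `C` to the subsets of `C ─ A`. It
  -- turns the ground set of a contraction into an interval of the original matroid.
  ∑-shift : ∀ {m} {A C : Subset m} → A ⊆ C → ∀ (f : Subset m → Carrier) →
            ∑ (subsets m) (λ B → ⟦ B ⊆? C ─ A ⟧ * f B) ≈
            ∑ (subsets m) (λ B → [ A ≤ B ≤ C ] * f (B ─ A))
  ∑-shift {zero}  {[]} {[]} A⊆C f = +-congʳ (*-congʳ (sym (*-identityˡ 1#)))
  ∑-shift {suc m} {a ∷ A} {c ∷ C} A⊆C f = trans
    (∑-subsets m (λ B → ⟦ B ⊆? (c ∷ C) ─ (a ∷ A) ⟧ * f B)) (trans (split a c A⊆C)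
    (sym (∑-subsets m (λ B → [ a ∷ A ≤ B ≤ c ∷ C ] * f (B ─ (a ∷ A))))))
    where
    rec : ∀ f → ∑ (subsets m) (λ B → ⟦ B ⊆? C ─ A ⟧ * f B) ≈
                ∑ (subsets m) (λ B → [ A ≤ B ≤ C ] * f (B ─ A))
    rec = ∑-shift (drop-∷-⊆ A⊆C)

    split : ∀ a c → a ∷ A ⊆ c ∷ C →
      ∑ (subsets m) (λ B → ⟦ inside ∷ B ⊆? (c ∷ C) ─ (a ∷ A) ⟧ * f (inside ∷ B)) +
      ∑ (subsets m) (λ B → ⟦ outside ∷ B ⊆? (c ∷ C) ─ (a ∷ A) ⟧ * f (outside ∷ B)) ≈
      ∑ (subsets m) (λ B → [ a ∷ A ≤ inside ∷ B ≤ c ∷ C ] * f ((inside ∷ B) ─ (a ∷ A))) +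
      ∑ (subsets m) (λ B → [ a ∷ A ≤ outside ∷ B ≤ c ∷ C ] * f ((outside ∷ B) ─ (a ∷ A)))
    -- The halves swap at an element of `A`: the interval forces it into `B`, while `C ─ A` excludes
    -- it.
    split inside inside _ = trans (+-comm _ _) (+-cong (rec (λ B → f (outside ∷ B)))
      (trans (∑-zero (subsets m) λ B → zeroˡ _)
        (sym (∑-zero (subsets m) λ B → trans (*-congʳ (zeroˡ _)) (zeroˡ _)))))
    split inside outside h = contradiction (h here) λ ()
    split outside inside _ = +-cong (rec (λ B → f (inside ∷ B))) (rec (λ B → f (outside ∷ B)))
    split outside outside _ = +-cong
      (trans (∑-zero (subsets m) λ B → zeroˡ _)
        (sym (∑-zero (subsets m) λ B → trans (*-congʳ (zeroʳ _)) (zeroˡ _))))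
      (rec (λ B → f (outside ∷ B)))

-- Möbius inversion on the lattice of subsets.

module MöbiusInversion {c ℓ} (R : CommutativeRing c ℓ) where
  open RingExpressions R hiding (zero)
  open SetoidReasoning setoid
  open FiniteSums R
  open Signs R
  open SubsetSums R
  open SemiringSolver commutativeSemiring using (solve; _:*_; _:=_)

  ∑-interval-empty : ∀ {m} {A C : Subset m} → ¬ A ⊆ C → ∀ (f : Subset m → Carrier) →
                     ∑ (subsets m) (λ B → [ A ≤ B ≤ C ] * f B) ≈ 0#
  ∑-interval-empty {m} {A} {C} A⊈C f = ∑-zero (subsets m) λ B → trans
    ([]-cong A B C λ A⊆B B⊆C → ⊥-elim (A⊈C λ x∈A → B⊆C (A⊆B x∈A))) (zeroʳ _)

  *-∑-comm : ∀ {a b} {A : Set a} {B : Set b} (xs : List A) (ys : List B) (f : A → Carrier)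
             (g : A → B → Carrier) →
             ∑ xs (λ x → f x * ∑ ys (g x)) ≈ ∑ ys (λ y → ∑ xs (λ x → f x * g x y))
  *-∑-comm xs ys f g = trans (∑-cong xs λ x → *-distribˡ-∑ ys (f x) (g x)) (∑-comm xs ys _)

  -- After the sums are exchanged, the coefficient of `f C` is the alternating sum between `A` and
  -- `C`, which `möbius` evaluates.
  möbius-inversion : ∀ {m} (A : Subset m) (f : Subset m → Carrier) →
    ∑ (subsets m) (λ B → ⟦ A ⊆? B ⟧ * ε B * ∑ (subsets m) (λ C → ⟦ B ⊆? C ⟧ * f C)) ≈ ε A * f A
  möbius-inversion {m} A f = begin
    ∑ (subsets m) (λ B → ⟦ A ⊆? B ⟧ * ε B * ∑ (subsets m) (λ C → ⟦ B ⊆? C ⟧ * f C))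
      ≈⟨ *-∑-comm (subsets m) (subsets m) _ _ ⟩
    ∑ (subsets m) (λ C → ∑ (subsets m) λ B → ⟦ A ⊆? B ⟧ * ε B * (⟦ B ⊆? C ⟧ * f C))
      ≈⟨ ∑-cong (subsets m) (λ C → ∑-cong (subsets m) λ B →
           solve 4 (λ a e b f → a :* e :* (b :* f) := f :* (a :* b :* e)) refl
             ⟦ A ⊆? B ⟧ (ε B) ⟦ B ⊆? C ⟧ (f C)) ⟩
    ∑ (subsets m) (λ C → ∑ (subsets m) λ B → f C * ([ A ≤ B ≤ C ] * ε B))
      ≈⟨ ∑-cong (subsets m) (λ C → *-distribˡ-∑ (subsets m) (f C) _) ⟨
    ∑ (subsets m) (λ C → f C * ∑ (subsets m) λ B → [ A ≤ B ≤ C ] * ε B)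
      ≈⟨ ∑-cong (subsets m) (λ C → trans (*-congˡ (möbius A C))
           (solve 3 (λ f e d → f :* (e :* d) := d :* (e :* f)) refl (f C) (ε A) ⟦ C ≟ A ⟧)) ⟩
    ∑ (subsets m) (λ C → ⟦ C ≟ A ⟧ * (ε A * f C))
      ≈⟨ ∑-≟ A (λ C → ε A * f C) ⟩
    ε A * f A ∎

-- Weighted sums over chains.

module ChainSums {c ℓ} (R : CommutativeRing c ℓ) where
  open RingExpressions R hiding (zero)
  open SetoidReasoning setoid
  open FiniteProducts R
  open FiniteSums R
  open Signs R
  open SubsetSums R
  open MöbiusInversion R
  open SemiringSolver commutativeSemiring using (solve; _:*_; _:=_; con)

  -- The total weight of the `n`-step chains from `A` to `E`, in transfer-matrix form. The starting
  -- set is variable so that induction on `n` applies.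
  path : ∀ {m} (E : Subset m) n → (Fin n → Subset m → Subset m → Carrier) → Subset m → Carrier
  path     E zero    w A = ⟦ A ≟ E ⟧
  path {m} E (suc n) w A = ∑ (subsets m) λ B →
    ⟦ A ⊆? B ⟧ * w zero A B * path E n (λ j → w (suc j)) B

  module _ {m} (E : Subset m) where

    -- The inclusions and the top condition enter as indicators, while the bottom condition is left
    -- out: the tail of a tuple then has a weight of the same kind.
    weight : ∀ n → (Fin n → Subset m → Subset m → Carrier) → Vector (Subset m) (suc n) → Carrier
    weight n w A =
      product {n} (λ j → ⟦ A (inject₁ j) ⊆? A (suc j) ⟧ * w j (A (inject₁ j)) (A (suc j)))
      * ⟦ A (fromℕ n) ≟ E ⟧

    ∑-tuples : ∀ n w A → ∑ (tuples (subsets m) n) (λ t → weight n w (A Vector.∷ t)) ≈ path E n w A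
    ∑-tuples zero    w A = trans (+-identityʳ _) (*-identityˡ _)
    ∑-tuples (suc n) w A = begin
      ∑ (tuples (subsets m) (suc n)) (λ t → weight (suc n) w (A Vector.∷ t))
        ≈⟨ ∑-cartesianProductWith Vector._∷_ (subsets m) (tuples (subsets m) n) _ ⟩
      ∑ (subsets m) (λ B → ∑ (tuples (subsets m) n) λ t → weight (suc n) w (A Vector.∷ (B Vector.∷ t)))
        ≈⟨ ∑-cong (subsets m) (λ B → ∑-cong (tuples (subsets m) n) λ t → *-assoc _ _ _) ⟩
      ∑ (subsets m) (λ B → ∑ (tuples (subsets m) n) λ t →
        ⟦ A ⊆? B ⟧ * w zero A B * weight n (λ j → w (suc j)) (B Vector.∷ t))
        ≈⟨ ∑-cong (subsets m) (λ B → *-distribˡ-∑ (tuples (subsets m) n) _ _) ⟨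
      ∑ (subsets m) (λ B → ⟦ A ⊆? B ⟧ * w zero A B *
        ∑ (tuples (subsets m) n) λ t → weight n (λ j → w (suc j)) (B Vector.∷ t))
        ≈⟨ ∑-cong (subsets m) (λ B → *-congˡ (∑-tuples n (λ j → w (suc j)) B)) ⟩
      path E (suc n) w A ∎

    ⟦isChain?⟧ : ∀ n w (A : Vector (Subset m) (suc n)) →
      ⟦ isChain? E n A ⟧ * product {n} (λ j → w j (A (inject₁ j)) (A (suc j))) ≈
      ⟦ A zero ≟ ⊥ ⟧ * weight n w A
    ⟦isChain?⟧ n w A = begin
      ⟦ isChain? E n A ⟧ * W
        ≈⟨ *-congʳ (trans (⟦⟧-×-dec (A zero ≟ ⊥) (all? step? ×-dec (A (fromℕ n) ≟ E)))
             (*-congˡ (trans (⟦⟧-×-dec (all? step?) (A (fromℕ n) ≟ E)) (*-congʳ (⟦⟧-all? n step?))))) ⟩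
      b * (S * t) * W
        ≈⟨ solve 4 (λ b s t w → b :* (s :* t) :* w := b :* (s :* w :* t)) refl b S t W ⟩
      b * (S * W * t)
        ≈⟨ *-congˡ (*-congʳ (product-* n (λ j → ⟦ step? j ⟧) _)) ⟨
      b * weight n w A ∎
      where
      step? : ∀ j → Dec (A (inject₁ j) ⊆ A (suc j))
      step? j = A (inject₁ j) ⊆? A (suc j)
      W = product {n} (λ j → w j (A (inject₁ j)) (A (suc j)))
      S = product {n} (λ j → ⟦ step? j ⟧)
      b = ⟦ A zero ≟ ⊥ ⟧
      t = ⟦ A (fromℕ n) ≟ E ⟧

    ∑-chains : ∀ n w →
      ∑ (chains E n) (λ C → product {n} (λ j → w j (Chain.A C (inject₁ j)) (Chain.A C (suc j)))) ≈
      path E n w ⊥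
    ∑-chains n w = begin
      ∑ (chains E n) (λ C → W (Chain.A C))
        ≈⟨ ∑-mapMaybe _ (tuples (subsets m) (suc n)) _ ⟩
      _ ≈⟨ ∑-cong (tuples (subsets m) (suc n)) (λ A → indicator A (isChain? E n A)) ⟩
      ∑ (tuples (subsets m) (suc n)) (λ A → ⟦ isChain? E n A ⟧ * W A)
        ≈⟨ ∑-cong (tuples (subsets m) (suc n)) (⟦isChain?⟧ n w) ⟩
      ∑ (tuples (subsets m) (suc n)) (λ A → ⟦ A zero ≟ ⊥ ⟧ * weight n w A)
        ≈⟨ ∑-cartesianProductWith Vector._∷_ (subsets m) (tuples (subsets m) n) _ ⟩
      ∑ (subsets m) (λ A → ∑ (tuples (subsets m) n) λ t → ⟦ A ≟ ⊥ ⟧ * weight n w (A Vector.∷ t))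
        ≈⟨ ∑-cong (subsets m) (λ A → *-distribˡ-∑ (tuples (subsets m) n) _ _) ⟨
      ∑ (subsets m) (λ A → ⟦ A ≟ ⊥ ⟧ * ∑ (tuples (subsets m) n) λ t → weight n w (A Vector.∷ t))
        ≈⟨ ∑-≟ {m} ⊥ (λ A → ∑ (tuples (subsets m) n) λ t → weight n w (A Vector.∷ t)) ⟩
      ∑ (tuples (subsets m) n) (λ t → weight n w (⊥ Vector.∷ t))
        ≈⟨ ∑-tuples n w ⊥ ⟩
      path E n w ⊥ ∎
      where
      W : Vector (Subset m) (suc n) → Carrier
      W A = product {n} (λ j → w j (A (inject₁ j)) (A (suc j)))

      -- Stated for an arbitrary decision, so that matching on it reduces both sides.
      indicator : ∀ A (d : Dec (IsChain E n A)) →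
        maybe′ (λ C → W (Chain.A C)) 0#
          (Maybe.map (λ c → record { A = A ; isChain = c }) (dec⇒maybe d)) ≈ ⟦ d ⟧ * W A
      indicator A (yes _) = sym (*-identityˡ _)
      indicator A (no _)  = sym (zeroˡ _)

    module _ (τ : Subset m → Carrier) (τE*εE≈1 : τ E * ε E ≈ 1#) where

      private
        -- Prepares the empty chain for `möbius A E`; the normalisation of `τ` at `E` absorbs the
        -- sign.
        base : ∀ A → ⟦ A ≟ E ⟧ ≈ τ A * (ε A * ⟦ E ≟ A ⟧)
        base A with A ≟ E | E ≟ A
        ... | yes ≡.refl | yes _  = sym (trans (*-congˡ (*-identityʳ _)) τE*εE≈1)
        ... | yes A≡E | no E≢A    = contradiction (≡.sym A≡E) E≢A
        ... | no A≢E  | yes E≡A   = contradiction (≡.sym E≡A) A≢E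
        ... | no _    | no _      = sym (trans (*-congˡ (zeroʳ _)) (zeroʳ _))

      -- For B ⊆ A′ ⊆ B′, with B from the first step and B′ from the rest of the chain,
      -- Möbius inversion over A′ leaves only the terms with B = B′.
      path-telescope : ∀ n (w : Fin n → Subset m → Subset m → Carrier)
        (v : Fin n → Subset m → Carrier) →
        (∀ j A A′ → A ⊆ A′ → A′ ⊆ E → w j A A′ * τ A′ ≈
           τ A * (ε A′ * ∑ (subsets m) (λ B → [ A ≤ B ≤ A′ ] * (ε B * v j B)))) →
        ∀ A → path E n w A ≈
          τ A * ∑ (subsets m) (λ B → [ A ≤ B ≤ E ] * (ε B * product {n} (λ j → v j B)))
      path-telescope zero w v h A = trans (base A) (*-congˡ (sym (trans
        (∑-cong (subsets m) λ B → *-congˡ (*-identityʳ (ε B))) (möbius A E))))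
      path-telescope (suc n) w v h A = begin
        ∑ (subsets m) (λ A′ → ⟦ A ⊆? A′ ⟧ * w zero A A′ * path E n (λ j → w (suc j)) A′)
          ≈⟨ ∑-cong (subsets m) (λ A′ → trans
               (*-congˡ (path-telescope n (λ j → w (suc j)) (λ j → v (suc j)) (λ j → h (suc j)) A′))
               (step A′)) ⟩
        ∑ (subsets m) (λ A′ → τ A * (ε A′ * T A′ * Q A′))
          ≈⟨ *-distribˡ-∑ (subsets m) (τ A) _ ⟨
        τ A * ∑ (subsets m) (λ A′ → ε A′ * T A′ * Q A′)
          ≈⟨ *-congˡ (∑-cong (subsets m) λ A′ →
               solve 3 (λ e t q → e :* t :* q := e :* q :* t) refl (ε A′) (T A′) (Q A′)) ⟩
        τ A * ∑ (subsets m) (λ A′ → ε A′ * Q A′ * T A′)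
          ≈⟨ *-congˡ (*-∑-comm (subsets m) (subsets m) _ _) ⟩
        τ A * ∑ (subsets m) (λ B → ∑ (subsets m) λ A′ →
          ε A′ * Q A′ * ([ A ≤ B ≤ A′ ] * (ε B * v zero B)))
          ≈⟨ *-congˡ (∑-cong (subsets m) λ B → trans
               (∑-cong (subsets m) λ A′ →
                 solve 6 (λ e q a b c d → e :* q :* (a :* b :* (c :* d)) := a :* (c :* d) :* (b :* e :* q))
                   refl (ε A′) (Q A′) ⟦ A ⊆? B ⟧ ⟦ B ⊆? A′ ⟧ (ε B) (v zero B))
               (sym (*-distribˡ-∑ (subsets m) _ _))) ⟩
        τ A * ∑ (subsets m) (λ B → ⟦ A ⊆? B ⟧ * (ε B * v zero B) *
          ∑ (subsets m) λ A′ → ⟦ B ⊆? A′ ⟧ * ε A′ * Q A′)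
          ≈⟨ *-congˡ (∑-cong (subsets m) λ B → *-congˡ (trans
               (∑-cong (subsets m) λ A′ → *-congˡ (∑-cong (subsets m) λ B′ → *-assoc _ _ _))
               (möbius-inversion B (λ B′ → ⟦ B′ ⊆? E ⟧ * (ε B′ * V B′))))) ⟩
        τ A * ∑ (subsets m) (λ B → ⟦ A ⊆? B ⟧ * (ε B * v zero B) *
          (ε B * (⟦ B ⊆? E ⟧ * (ε B * V B))))
          -- Three copies of `ε B` have met: from the first step, from the inversion and from the
          -- rest of the chain. Two of them cancel.
          ≈⟨ *-congˡ (∑-cong (subsets m) λ B → trans
               (solve 5 (λ a b e v V → a :* (e :* v) :* (e :* (b :* (e :* V))) :=
                 (e :* e) :* (a :* b :* (e :* (v :* V)))) refl
                 ⟦ A ⊆? B ⟧ ⟦ B ⊆? E ⟧ (ε B) (v zero B) (V B))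
               (trans (*-congʳ (σ² ∣ B ∣)) (*-identityˡ _))) ⟩
        τ A * ∑ (subsets m) (λ B → [ A ≤ B ≤ E ] * (ε B * (v zero B * V B))) ∎
        where
        V T Q : Subset m → Carrier
        V B  = product {n} (λ j → v (suc j) B)
        T A′ = ∑ (subsets m) (λ B → [ A ≤ B ≤ A′ ] * (ε B * v zero B))
        Q A′ = ∑ (subsets m) (λ B → [ A′ ≤ B ≤ E ] * (ε B * V B))

        -- The hypothesis `h` applies only when `A ⊆ A′ ⊆ E`. Otherwise `Q A′` or `T A′` is a sum
        -- over an empty interval, and both sides vanish.
        step : ∀ A′ → ⟦ A ⊆? A′ ⟧ * w zero A A′ * (τ A′ * Q A′) ≈ τ A * (ε A′ * T A′ * Q A′)
        step A′ with A ⊆? A′ | A′ ⊆? E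
        ... | _ | no A′⊈E = trans
          (*-congˡ (trans (*-congˡ Q≈0) (zeroʳ _)))
          (trans (zeroʳ _) (sym (trans (*-congˡ (trans (*-congˡ Q≈0) (zeroʳ _))) (zeroʳ _))))
          where
          Q≈0 : Q A′ ≈ 0#
          Q≈0 = ∑-interval-empty A′⊈E (λ B → ε B * V B)
        ... | no A⊈A′ | yes _ = trans
          (trans (*-congʳ (zeroˡ _)) (zeroˡ _))
          (sym (trans (*-congˡ (*-congʳ (trans (*-congˡ T≈0) (zeroʳ _))))
            (trans (*-congˡ (zeroˡ _)) (zeroʳ _))))
          where
          T≈0 : T A′ ≈ 0#
          T≈0 = ∑-interval-empty A⊈A′ (λ B → ε B * v zero B)
        ... | yes A⊆A′ | yes A′⊆E = begin
          1# * w zero A A′ * (τ A′ * Q A′)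
            ≈⟨ solve 3 (λ w t q → con 1 :* w :* (t :* q) := w :* t :* q) refl (w zero A A′) (τ A′) (Q A′) ⟩
          w zero A A′ * τ A′ * Q A′
            ≈⟨ *-congʳ (h zero A A′ A⊆A′ A′⊆E) ⟩
          τ A * (ε A′ * T A′) * Q A′
            ≈⟨ *-assoc _ _ _ ⟩
          τ A * (ε A′ * T A′ * Q A′) ∎

-- Set differences and truncated subtraction.

∪-─ : ∀ {m} {A B : Subset m} → A ⊆ B → A ∪ (B ─ A) ≡ B
∪-─ {A = []}          {[]}          _   = ≡.refl
∪-─ {A = inside  ∷ A} {inside  ∷ B} A⊆B = ≡.cong (inside ∷_) (∪-─ (drop-∷-⊆ A⊆B))
∪-─ {A = inside  ∷ A} {outside ∷ B} A⊆B = contradiction (A⊆B here) λ ()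
∪-─ {A = outside ∷ A} {b       ∷ B} A⊆B = ≡.cong (b ∷_) (∪-─ (drop-∷-⊆ A⊆B))

∣─∣ : ∀ {m} {A B : Subset m} → A ⊆ B → ∣ B ─ A ∣ ≡ ∣ B ∣ ∸ ∣ A ∣
∣─∣ {A = A} {B} A⊆B = ≡.trans (≡.sym (ℕₚ.m+n∸m≡n ∣ A ∣ _)) (≡.cong (_∸ ∣ A ∣) (add A⊆B))
  where
  add : ∀ {m} {A B : Subset m} → A ⊆ B → ∣ A ∣ ℕ.+ ∣ B ─ A ∣ ≡ ∣ B ∣
  add {A = []}          {[]}          _   = ≡.refl
  add {A = inside  ∷ A} {inside  ∷ B} A⊆B = ≡.cong suc (add (drop-∷-⊆ A⊆B))
  add {A = inside  ∷ A} {outside ∷ B} A⊆B = contradiction (A⊆B here) λ ()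
  add {A = outside ∷ A} {inside  ∷ B} A⊆B =
    ≡.trans (ℕₚ.+-suc _ _) (≡.cong suc (add (drop-∷-⊆ A⊆B)))
  add {A = outside ∷ A} {outside ∷ B} A⊆B = add (drop-∷-⊆ A⊆B)

∸-+-∸ : ∀ {a b c} → b ≤ a → c ≤ b → (a ∸ b) ℕ.+ (b ∸ c) ≡ a ∸ c
∸-+-∸ {a} {b} {c} b≤a c≤b = ≡.trans (≡.sym (ℕₚ.+-∸-assoc (a ∸ b) c≤b))
  (≡.cong (_∸ c) (ℕₚ.m∸n+n≡m b≤a))

∸-∸-∸ : ∀ {a b c} → c ≤ b → (a ∸ c) ∸ (b ∸ c) ≡ a ∸ b
∸-∸-∸ {a} {b} {c} c≤b = ≡.trans (ℕₚ.∸-+-assoc a c (b ∸ c)) (≡.cong (a ∸_) (ℕₚ.m+[n∸m]≡n c≤b))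

-- Additivity of nullity: for `A ⊆ B` of sizes `a`, `b` and ranks `r`, `s`, the nullity of `A` and
-- that of `B ─ A` in the contraction by `A` add up to the nullity of `B`.
nullity-+ : ∀ {a b r s} → r ≤ a → a ≤ b → r ≤ s → s ∸ r ≤ b ∸ a →
            (a ∸ r) ℕ.+ ((b ∸ a) ∸ (s ∸ r)) ≡ b ∸ s
nullity-+ {a} {b} {r} {s} r≤a a≤b r≤s s∸r≤b∸a = begin
  (a ∸ r) ℕ.+ ((b ∸ a) ∸ (s ∸ r))  ≡⟨ ℕₚ.+-∸-assoc (a ∸ r) s∸r≤b∸a ⟨
  ((a ∸ r) ℕ.+ (b ∸ a)) ∸ (s ∸ r)  ≡⟨ ≡.cong (_∸ (s ∸ r)) (ℕₚ.+-comm (a ∸ r) (b ∸ a)) ⟩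
  ((b ∸ a) ℕ.+ (a ∸ r)) ∸ (s ∸ r)  ≡⟨ ≡.cong (_∸ (s ∸ r)) (∸-+-∸ a≤b r≤a) ⟩
  (b ∸ r) ∸ (s ∸ r)                ≡⟨ ∸-∸-∸ r≤s ⟩
  b ∸ s                            ∎
  where open ≡.≡-Reasoning

-- Tutte polynomials of chain minors and the convolution over a general ring.

module Convolution {c ℓ} (R : CommutativeRing c ℓ) {m} (M : Matroid m) where
  open RingExpressions R hiding (zero)
  open SetoidReasoning setoid
  open FiniteProducts R
  open FiniteSums R
  open Signs R
  open SubsetSums R
  open ChainSums R
  open RootsOfUnity R
  open Exp semiring using (^-congˡ; ^-congʳ; ^-homo-*)
  open SemiringSolver commutativeSemiring using (solve; _:*_; _:=_)
  open Matroid M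

  -- The Tutte polynomial of `M | A′ / A` with the rank functions unfolded. It depends on the sets
  -- alone and not on inclusion proofs, as the weights in `∑-chains` must.
  subquotientTutte : Carrier → Carrier → Subset m → Subset m → Carrier
  subquotientTutte x y A A′ = ∑ (subsetsOf (A′ ─ A)) λ B →
    (x - 1#) ^ ((rk (A ∪ (A′ ─ A)) ∸ rk A) ∸ (rk (A ∪ B) ∸ rk A)) *
    (y - 1#) ^ (∣ B ∣ ∸ (rk (A ∪ B) ∸ rk A))

  stepWeight : Carrier → Carrier → Subset m → Subset m → Carrier
  stepWeight x y A A′ =
    (1# - x) ^ (rk (A′ ∪ (E ─ A′)) ∸ rk A′) * (1# - y) ^ (∣ A ∣ ∸ rk A) *
    subquotientTutte x y A A′

  -- The Tutte summand of `B` up to sign, in the base `1# - z` to which `product-roots` applies.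
  rankWeight : Carrier → Carrier → Subset m → Carrier
  rankWeight x y B = (1# - x) ^ (rk E ∸ rk B) * (1# - y) ^ (∣ B ∣ ∸ rk B)

  -- Up to the constant (-1)^(rk E), the sign (-1)^(∣A∣ - rk A) left over at the bottom
  -- of a chain starting at A.
  τ : Subset m → Carrier
  τ A = ε A * (σ (rk A) * σ (rk E))

  subquotientTutte-interval : ∀ x y {A A′} → A ⊆ A′ → A′ ⊆ E → subquotientTutte x y A A′ ≈
    ∑ (subsets m) λ B → [ A ≤ B ≤ A′ ] *
      ((x - 1#) ^ (rk A′ ∸ rk B) * (y - 1#) ^ ((∣ B ∣ ∸ ∣ A ∣) ∸ (rk B ∸ rk A)))
  subquotientTutte-interval x y {A} {A′} A⊆A′ A′⊆E = begin
    subquotientTutte x y A A′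
      ≈⟨ ∑-filter (_⊆? (A′ ─ A)) (subsets m) f ⟩
    ∑ (subsets m) (λ B → ⟦ B ⊆? A′ ─ A ⟧ * f B)
      ≈⟨ ∑-shift A⊆A′ f ⟩
    ∑ (subsets m) (λ B → [ A ≤ B ≤ A′ ] * f (B ─ A))
      ≈⟨ ∑-cong (subsets m) (λ B → []-cong A B A′ λ A⊆B B⊆A′ → *-cong
           (^-congʳ (x - 1#) (≡.trans
             (≡.cong₂ (λ S T → (rk S ∸ rk A) ∸ (rk T ∸ rk A)) (∪-─ A⊆A′) (∪-─ A⊆B))
             (∸-∸-∸ (monotone A B A⊆B (λ i → A′⊆E (B⊆A′ i))))))
           (^-congʳ (y - 1#)
             (≡.cong₂ (λ k T → k ∸ (rk T ∸ rk A)) (∣─∣ A⊆B) (∪-─ A⊆B)))) ⟩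
    _ ∎
    where
    f : Subset m → Carrier
    f B = (x - 1#) ^ ((rk (A ∪ (A′ ─ A)) ∸ rk A) ∸ (rk (A ∪ B) ∸ rk A)) *
          (y - 1#) ^ (∣ B ∣ ∸ (rk (A ∪ B) ∸ rk A))

  module _ {A B A′ : Subset m} (A⊆B : A ⊆ B) (B⊆A′ : B ⊆ A′) (A′⊆E : A′ ⊆ E) where
    private
      B⊆E : B ⊆ E
      B⊆E i = A′⊆E (B⊆A′ i)
      A⊆E : A ⊆ E
      A⊆E i = B⊆E (A⊆B i)
      p = rk A′ ∸ rk B
      q = (∣ B ∣ ∸ ∣ A ∣) ∸ (rk B ∸ rk A)

      rkA≤rkB : rk A ≤ rk B
      rkA≤rkB = monotone A B A⊆B B⊆E
      rkB≤rkA′ : rk B ≤ rk A′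
      rkB≤rkA′ = monotone B A′ B⊆A′ A′⊆E
      ∣A∣≤∣B∣ : ∣ A ∣ ≤ ∣ B ∣
      ∣A∣≤∣B∣ = Subset.p⊆q⇒∣p∣≤∣q∣ A⊆B

      -- This is the axiom `rk≤∣∣` for the minor `M | B / A` at its full ground set; it makes the
      -- subtraction in `q` exact.
      rank-gap≤size-gap : rk B ∸ rk A ≤ ∣ B ∣ ∸ ∣ A ∣
      rank-gap≤size-gap = ≡.subst₂ _≤_ (≡.cong (λ S → rk S ∸ rk A) (∪-─ A⊆B)) (∣─∣ A⊆B)
        (Matroid.rk≤∣∣ (contract (restrict M B B⊆E) A A⊆B) (B ─ A) (λ i → i))

      σp : σ p ≈ σ (rk A′) * σ (rk B)
      σp = σ-∸ rkB≤rkA′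

      σq : σ q ≈ ε B * ε A * (σ (rk B) * σ (rk A))
      σq = trans (σ-∸ rank-gap≤size-gap) (*-cong (σ-∸ ∣A∣≤∣B∣) (σ-∸ rkA≤rkB))

    -- The signs of `rk A′` and `rk B` occur twice and cancel, so the rank sign of `A′` in `τ A′` is
    -- exchanged for that of `A`.
    signs : σ p * σ q * τ A′ ≈ τ A * (ε A′ * ε B)
    signs = begin
      σ p * σ q * τ A′
        ≈⟨ *-congʳ (*-cong σp σq) ⟩
      r′ * s * (b * a * (s * r)) * (a′ * (r′ * e))
        ≈⟨ solve 7 (λ r′ s b a r a′ e →
             r′ :* s :* (b :* a :* (s :* r)) :* (a′ :* (r′ :* e)) :=
             (r′ :* r′) :* (s :* s) :* (a :* (r :* e) :* (a′ :* b))) refl r′ s b a r a′ e ⟩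
      (r′ * r′) * (s * s) * (a * (r * e) * (a′ * b))
        ≈⟨ *-congʳ (*-cong (σ² (rk A′)) (σ² (rk B))) ⟩
      1# * 1# * (a * (r * e) * (a′ * b))
        ≈⟨ trans (*-congʳ (*-identityˡ 1#)) (*-identityˡ _) ⟩
      τ A * (ε A′ * ε B) ∎
      where
      r′ = σ (rk A′)
      s  = σ (rk B)
      r  = σ (rk A)
      e  = σ (rk E)
      a  = ε A
      b  = ε B
      a′ = ε A′

    -- The prefactor exponents complete those of the Tutte summand: ranks add up to `rk E ∸ rk B`
    -- and nullities to `∣ B ∣ ∸ rk B`. Apart from signs, `A` and `A′` disappear.
    term-rankWeight : ∀ x y →
      (1# - x) ^ (rk E ∸ rk A′) * (1# - y) ^ (∣ A ∣ ∸ rk A) * ((x - 1#) ^ p * (y - 1#) ^ q) * τ A′ ≈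
      τ A * ε A′ * (ε B * rankWeight x y B)
    term-rankWeight x y = begin
      X ^ a * Y ^ b * ((x - 1#) ^ p * (y - 1#) ^ q) * τ A′
        ≈⟨ *-congʳ (*-congˡ (*-cong (^-flip x p) (^-flip y q))) ⟩
      X ^ a * Y ^ b * (σ p * X ^ p * (σ q * Y ^ q)) * τ A′
        ≈⟨ solve 7 (λ Xa Yb s Xp t Yq u →
             Xa :* Yb :* (s :* Xp :* (t :* Yq)) :* u := s :* t :* u :* ((Xa :* Xp) :* (Yb :* Yq)))
             refl (X ^ a) (Y ^ b) (σ p) (X ^ p) (σ q) (Y ^ q) (τ A′) ⟩
      σ p * σ q * τ A′ * (X ^ a * X ^ p * (Y ^ b * Y ^ q))
        ≈⟨ *-cong signs (sym (*-cong (^-homo-* X a p) (^-homo-* Y b q))) ⟩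
      τ A * (ε A′ * ε B) * (X ^ (a ℕ.+ p) * Y ^ (b ℕ.+ q))
        ≈⟨ *-congˡ (*-cong
             (^-congʳ X (∸-+-∸ (monotone A′ E A′⊆E (λ i → i)) rkB≤rkA′))
             (^-congʳ Y (nullity-+ (rk≤∣∣ A A⊆E) ∣A∣≤∣B∣ rkA≤rkB rank-gap≤size-gap))) ⟩
      τ A * (ε A′ * ε B) * rankWeight x y B
        ≈⟨ solve 4 (λ t a b w → t :* (a :* b) :* w := t :* a :* (b :* w)) refl
             (τ A) (ε A′) (ε B) (rankWeight x y B) ⟩
      τ A * ε A′ * (ε B * rankWeight x y B) ∎
      where
      X = 1# - x
      Y = 1# - y
      a = rk E ∸ rk A′
      b = ∣ A ∣ ∸ rk A

  -- Summing `term-rankWeight` over the interval supplies the hypothesis of `path-telescope`.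
  stepWeight-τ : ∀ x y A A′ → A ⊆ A′ → A′ ⊆ E → stepWeight x y A A′ * τ A′ ≈
    τ A * (ε A′ * ∑ (subsets m) (λ B → [ A ≤ B ≤ A′ ] * (ε B * rankWeight x y B)))
  stepWeight-τ x y A A′ A⊆A′ A′⊆E = begin
    (1# - x) ^ (rk (A′ ∪ (E ─ A′)) ∸ rk A′) * Y * subquotientTutte x y A A′ * τ A′
      ≈⟨ *-congʳ (*-cong
           (*-congʳ (^-congʳ (1# - x) (≡.cong (λ S → rk S ∸ rk A′) (∪-─ A′⊆E))))
           (subquotientTutte-interval x y A⊆A′ A′⊆E)) ⟩
    X * Y * ∑ (subsets m) (λ B → [ A ≤ B ≤ A′ ] * t B) * τ A′
      ≈⟨ solve 4 (λ X Y S t → X :* Y :* S :* t := X :* Y :* t :* S) refl X Y _ (τ A′) ⟩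
    X * Y * τ A′ * ∑ (subsets m) (λ B → [ A ≤ B ≤ A′ ] * t B)
      ≈⟨ *-distribˡ-∑ (subsets m) _ _ ⟩
    ∑ (subsets m) (λ B → X * Y * τ A′ * ([ A ≤ B ≤ A′ ] * t B))
      ≈⟨ ∑-cong (subsets m) (λ B → trans
           (solve 5 (λ X Y u i t → X :* Y :* u :* (i :* t) := i :* (X :* Y :* t :* u)) refl
              X Y (τ A′) [ A ≤ B ≤ A′ ] (t B))
           (trans ([]-cong A B A′ λ A⊆B B⊆A′ → term-rankWeight A⊆B B⊆A′ A′⊆E x y)
           (solve 3 (λ i a b → i :* (a :* b) := a :* (i :* b)) refl [ A ≤ B ≤ A′ ] (τ A * ε A′) _))) ⟩
    ∑ (subsets m) (λ B → τ A * ε A′ * ([ A ≤ B ≤ A′ ] * (ε B * rankWeight x y B)))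
      ≈⟨ *-distribˡ-∑ (subsets m) _ _ ⟨
    τ A * ε A′ * ∑ (subsets m) (λ B → [ A ≤ B ≤ A′ ] * (ε B * rankWeight x y B))
      ≈⟨ *-assoc _ _ _ ⟩
    _ ∎
    where
    X = (1# - x) ^ (rk E ∸ rk A′)
    Y = (1# - y) ^ (∣ A ∣ ∸ rk A)
    t : Subset m → Carrier
    t B = (x - 1#) ^ (rk A′ ∸ rk B) * (y - 1#) ^ ((∣ B ∣ ∸ ∣ A ∣) ∸ (rk B ∸ rk A))

  τE*εE≈1 : τ E * ε E ≈ 1#
  τE*εE≈1 = begin
    ε E * (σ (rk E) * σ (rk E)) * ε E  ≈⟨ *-congʳ (*-congˡ (σ² (rk E))) ⟩
    ε E * 1# * ε E                     ≈⟨ *-congʳ (*-identityʳ _) ⟩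
    ε E * ε E                          ≈⟨ σ² ∣ E ∣ ⟩
    1#                                 ∎

  τ⊥ : τ ⊥ ≈ σ (rk E)
  τ⊥ = trans (*-cong (^-congʳ (- 1#) (Subset.∣⊥∣≡0 m)) (*-congʳ (^-congʳ (- 1#) rk⊥≡0)))
    (trans (*-identityˡ _) (*-identityˡ _))
    where
    rk⊥≡0 : rk ⊥ ≡ 0
    rk⊥≡0 = ℕₚ.n≤0⇒n≡0 (≡.subst (rk ⊥ ≤_) (Subset.∣⊥∣≡0 m) (rk≤∣∣ ⊥ Subset.⊥⊆))

  tutte-term : ∀ x y B → B ⊆ E →
    (x - 1#) ^ (rk E ∸ rk B) * (y - 1#) ^ (∣ B ∣ ∸ rk B) ≈ σ (rk E) * (ε B * rankWeight x y B)
  tutte-term x y B B⊆E = begin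
    (x - 1#) ^ a * (y - 1#) ^ b
      ≈⟨ *-cong (^-flip x a) (^-flip y b) ⟩
    σ a * X * (σ b * Y)
      ≈⟨ *-cong (*-congʳ (σ-∸ (monotone B E B⊆E (λ i → i)))) (*-congʳ (σ-∸ (rk≤∣∣ B B⊆E))) ⟩
    e * s * X * (ε B * s * Y)
      ≈⟨ solve 5 (λ e s X b Y → e :* s :* X :* (b :* s :* Y) := (s :* s) :* (e :* (b :* (X :* Y))))
           refl e s X (ε B) Y ⟩
    (s * s) * (e * (ε B * (X * Y)))
      ≈⟨ trans (*-congʳ (σ² (rk B))) (*-identityˡ _) ⟩
    e * (ε B * (X * Y)) ∎
    where
    a = rk E ∸ rk B
    b = ∣ B ∣ ∸ rk B
    X = (1# - x) ^ a
    Y = (1# - y) ^ b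
    e = σ (rk E)
    s = σ (rk B)

  -- Brings the left-hand side into the form that `path-telescope` yields for chains starting at
  -- `⊥`.
  tutte-rankWeight : ∀ x y → tutte M x y ≈
    τ ⊥ * ∑ (subsets m) (λ B → [ ⊥ ≤ B ≤ E ] * (ε B * rankWeight x y B))
  tutte-rankWeight x y = begin
    tutte M x y
      ≈⟨ ∑-filter (_⊆? E) (subsets m) _ ⟩
    ∑ (subsets m) (λ B → ⟦ B ⊆? E ⟧ * ((x - 1#) ^ (rk E ∸ rk B) * (y - 1#) ^ (∣ B ∣ ∸ rk B)))
      ≈⟨ ∑-cong (subsets m) (λ B → trans (⟦⟧-*-cong (B ⊆? E) (tutte-term x y B))
           (trans (*-congʳ (sym (trans (*-congʳ (⟦⊥⊆?⟧ B)) (*-identityˡ _))))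
           (solve 3 (λ i a b → i :* (a :* b) := a :* (i :* b)) refl [ ⊥ ≤ B ≤ E ] (σ (rk E)) _))) ⟩
    ∑ (subsets m) (λ B → σ (rk E) * ([ ⊥ ≤ B ≤ E ] * (ε B * rankWeight x y B)))
      ≈⟨ *-distribˡ-∑ (subsets m) _ _ ⟨
    σ (rk E) * ∑ (subsets m) (λ B → [ ⊥ ≤ B ≤ E ] * (ε B * rankWeight x y B))
      ≈⟨ *-congʳ τ⊥ ⟨
    _ ∎
    where
    ⟦⊥⊆?⟧ : ∀ B → ⟦ ⊥ ⊆? B ⟧ ≈ 1#
    ⟦⊥⊆?⟧ B with ⊥ ⊆? B
    ... | yes _   = refl
    ... | no ⊥⊈B = ⊥-elim (⊥⊈B Subset.⊥⊆)

  module _ (n : ℕ) (ζ : Carrier) (prim : IsPrimitiveRoot R (suc n) ζ) (x y : Carrier) where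

    private
      N = suc n
      twist : Carrier → Fin N → Carrier
      twist z j = ζ ^ toℕ j * z

    -- The exponents do not depend on `j`, so they move outside the products, where `product-roots`
    -- applies once for `x` and once for `y`.
    product-rankWeight : ∀ B →
      product {N} (λ j → rankWeight (twist x j) (twist y j) B) ≈ rankWeight (x ^ N) (y ^ N) B
    product-rankWeight B = begin
      product {N} (λ j → rankWeight (twist x j) (twist y j) B)
        ≈⟨ product-* N (λ j → (1# - twist x j) ^ a) (λ j → (1# - twist y j) ^ b) ⟩
      product {N} (λ j → (1# - twist x j) ^ a) * product {N} (λ j → (1# - twist y j) ^ b)
        ≈⟨ *-cong (power x a) (power y b) ⟩
      rankWeight (x ^ N) (y ^ N) B ∎
      where
      a = rk E ∸ rk B
      b = ∣ B ∣ ∸ rk B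
      power : ∀ z k → product {N} (λ j → (1# - twist z j) ^ k) ≈ (1# - z ^ N) ^ k
      power z k = trans (product-^ N (λ j → 1# - twist z j) k) (^-congˡ k (product-roots n ζ prim z))

    convolution : tutte M (x ^ N) (y ^ N) ≈
      ∑ (chains E N) λ C → product {N} λ j →
        stepWeight (twist x j) (twist y j) (Chain.A C (inject₁ j)) (Chain.A C (suc j))
    convolution = begin
      tutte M (x ^ N) (y ^ N)
        ≈⟨ tutte-rankWeight (x ^ N) (y ^ N) ⟩
      τ ⊥ * ∑ (subsets m) (λ B → [ ⊥ ≤ B ≤ E ] * (ε B * rankWeight (x ^ N) (y ^ N) B))
        ≈⟨ *-congˡ (∑-cong (subsets m) λ B → *-congˡ (*-congˡ (product-rankWeight B))) ⟨
      τ ⊥ * ∑ (subsets m) (λ B → [ ⊥ ≤ B ≤ E ] *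
        (ε B * product {N} (λ j → rankWeight (twist x j) (twist y j) B)))
        ≈⟨ path-telescope E τ τE*εE≈1 N (λ j → stepWeight (twist x j) (twist y j))
             (λ j → rankWeight (twist x j) (twist y j))
             (λ j → stepWeight-τ (twist x j) (twist y j)) ⊥ ⟨
      path E N (λ j → stepWeight (twist x j) (twist y j)) ⊥
        ≈⟨ ∑-chains E N (λ j → stepWeight (twist x j) (twist y j)) ⟨
      _ ∎

-- The convolution formula in the bivariate polynomial ring.

proposition5p14 : ∀ {c ℓ} (K : CommutativeRing c ℓ) (n : ℕ) .{{_ : NonZero n}}
    (ξ : CommutativeRing.Carrier K) → IsPrimitiveRoot K n ξ →
    ∀ {m} (M : Matroid m) →
    let open Bivariate K
        open RingExpressions K[x,y]
    in
    tutte M (x ^ n) (y ^ n) ≈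
    ∑ (chains (Matroid.E M) n) λ C →
      product λ j →
        let open ChainMinors M C j
            ξʲ = scalar ξ ^ toℕ j
        in
        (1# - ξʲ * x) ^ rank contraction
        * (1# - ξʲ * y) ^ corank restriction
        * tutte subquotient (ξʲ * x) (ξʲ * y)
proposition5p14 K (suc n) ξ prim M =
  Convolution.convolution K[x,y] M n (scalar ξ)
    -- Primitivity is transferred twice, from `K` to `K[x]` and on to `(K[x])[y]`. The factors in
    -- the statement unfold to `stepWeight` definitionally.
    (ConstantPolynomials.const-isPrimitiveRoot _ (ConstantPolynomials.const-isPrimitiveRoot K prim)) x y
  where open Bivariate K
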